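{- For every integer $n\ge 0$ and every integer $m$, the number of overpartitions $\vec{\pi}$ of $n$ with $\operatorname{crank2}(\vec{\pi})=m$ equals $\overline{M2}(m,n)$, where the integers $\overline{M2}(m,n)$ are defined by $$\sum_{n=0}^\infty\sum_{m}\overline{M2}(m,n)z^mq^n=\frac{(-q;q)_\infty(q^2;q^2)_\infty}{(q;q^2)_\infty(zq^2;q^2)_\infty(z^{ -1}q^2;q^2)_\infty}.$$
   Context: Notation: $(a;q)_\infty=\prod_{k=0}^\infty(1-aq^k)$; the generating function is expanded as a formal power series in $q$ whose coefficients are Laurent polynomials in $z$. An overpartition of $n$ is a partition of $n$ in which the first occurrence of each part size may be overlined. It is identified with a triple $\vec{\pi}=(\pi_1,\pi_2,\pi_3)\in\mathcal{PD}\times\mathcal{PE}\times\mathcal{PO}$ with $|\pi_1|+|\pi_2|+|\pi_3|=n$, where $\mathcal{PD}$, $\mathcal{PE}$, $\mathcal{PO}$ are the sets of partitions into distinct parts, into even parts, and into odd parts respectively (each including the empty partition $\varnothing$), $|\pi|$ is the sum of the parts of $\pi$, $\pi_1$ consists of the overlined parts, $\pi_2$ of the even non-overlined parts, and $\pi_3$ of the odd non-overlined parts. For a non-empty partition $\pi$, let $\ell(\pi)$ be its largest part, $\omega(\pi)$ the number of ones in $\pi$, and $\mu(\pi)$ the number of parts of $\pi$ larger than $\omega(\pi)$. The crank is $$\operatorname{crank}(\pi)=\begin{cases}\ell(\pi)&\text{if }\omega(\pi)=0,\\ \mu(\pi)-\omega(\pi)&\text{otherwise.}\end{cases}$$ For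 $\pi\in\mathcal{PE}$, $\frac{\pi}{2}$ denotes the partition obtained by dividing each part of $\pi$ by $2$. For a non-empty partition $\pi$ into distinct parts define $\kappa(\pi)$ as follows. Case I: if $\ell(\pi)\ge 4$, then $\kappa(\pi)=0$ if $\ell(\pi)-1$ or $\ell(\pi)-2$ (at least one of them) is a part of $\pi$, and $\kappa(\pi)=1$ otherwise. Case II: if $\ell(\pi)\in\{2,3\}$, then $\kappa(\pi)=1$ if $\pi$ has only one part, and $\kappa(\pi)=0$ otherwise. Case III: if $\ell(\pi)=1$, then $\kappa(\pi)=0$. For an overpartition $\vec\pi=(\pi_1,\pi_2,\pi_3)\in\mathcal{PD}\times\mathcal{PE}\times\mathcal{PO}$ define $$\operatorname{crank2}(\vec{\pi})=\begin{cases}\operatorname{crank}\bigl(\frac{\pi_2}{2}\bigr)&\text{if }\pi_2\ne\varnothing,\\ \kappa(\pi_1)&\text{if }\pi_2=\varnothing\text{ and }\pi_1\ne\varnothing,\\ 0&\text{otherwise.}\end{cases}$$ -}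

module Defs where

open import Data.Bool using (if_then_else_; _∨_)
open import Data.Integer as ℤ using (ℤ; +_; 0ℤ; 1ℤ; -1ℤ; _⊖_)
import Data.Integer.Properties as ℤₚ
open import Data.Integer.Tactic.RingSolver using (solve-∀)
open import Data.List using (List; []; _∷_; [_]; _++_; map; foldr; filter; length)
open import Data.List.Relation.Unary.All using (All)
open import Data.List.Relation.Unary.Linked using (Linked)
open import Data.List.Relation.Unary.Unique.Propositional using (Unique)
open import Data.Nat using (ℕ; zero; suc; _+_; _∸_; _⊔_; _/_; _<_; _≥_; z≤n; s≤s; _≟_; _≤?_; _<?_)
import Data.Nat.Properties as ℕₚ
open import Data.Nat.ListAction using (sum)
open import Data.List.Membership.DecPropositional _≟_ using (_∈?_)
open import Data.Nat.Divisibility using (_∣_; _∤_)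
open import Data.Product using (_×_; _,_)
open import Function using (_∘_)
open import Relation.Nullary using (does; yes; no; contradiction)
open import Relation.Binary.PropositionalEquality
  using (_≡_; refl; sym; trans; cong; cong₂; module ≡-Reasoning)

------------------------------------------------------------------------
-- Partitions and overpartitions

record IsPartition (π : List ℕ) : Set where
  field
    parts-positive : All (0 <_) π
    nonincreasing  : Linked _≥_ π

PD PE PO : List ℕ → Set
PD π = IsPartition π × Unique π
PE π = IsPartition π × All (2 ∣_) π
PO π = IsPartition π × All (2 ∤_) π

-- The proof fields are irrelevant, so that propositional equality of
-- overpartitions is equality of the three lists of parts.
record Overpartition (n : ℕ) : Set where
  field
    π₁ π₂ π₃ : List ℕ
    .π₁∈PD   : PD π₁
    .π₂∈PE   : PE π₂
    .π₃∈PO   : PO π₃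
    .size    : sum π₁ + sum π₂ + sum π₃ ≡ n

------------------------------------------------------------------------
-- The statistics.  crank and κ are meaningful for non-empty partitions
-- only, and crank2 applies them to such partitions only.

ℓ ω μ : List ℕ → ℕ
ℓ π = foldr _⊔_ 0 π
ω π = length (filter (_≟ 1) π)
μ π = length (filter (ω π <?_) π)

crank : List ℕ → ℤ
crank π = if does (ω π ≟ 0) then + ℓ π else μ π ⊖ ω π

half : List ℕ → List ℕ
half = map (_/ 2)

κ : List ℕ → ℤ
κ π =
  if does (4 ≤? ℓ π) then
    (if does ((ℓ π ∸ 1) ∈? π) ∨ does ((ℓ π ∸ 2) ∈? π) then 0ℤ else 1ℤ)
  else if does (2 ≤? ℓ π) then
    (if does (length π ≟ 1) then 1ℤ else 0ℤ)
  else
    0ℤ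

crank2-parts : (π₁ π₂ : List ℕ) → ℤ
crank2-parts _            π₂@(_ ∷ _) = crank (half π₂)
crank2-parts π₁@(_ ∷ _)   []         = κ π₁
crank2-parts []           []         = 0ℤ

crank2 : ∀ {n} → Overpartition n → ℤ
crank2 π = crank2-parts (Overpartition.π₁ π) (Overpartition.π₂ π)

------------------------------------------------------------------------
-- Laurent polynomials in z over ℤ: a list of pairs (i , c) stands for the
-- sum of the c zⁱ.  Exponents may repeat, so equality is _≈_.

Laurent : Set
Laurent = List (ℤ × ℤ)

coeff : Laurent → ℤ → ℤ
coeff []            m = 0ℤ
coeff ((i , c) ∷ a) m = (if does (i ℤ.≟ m) then c else 0ℤ) ℤ.+ coeff a m

infix 4 _≈_
_≈_ : Laurent → Laurent → Set
a ≈ b = ∀ m → coeff a m ≡ coeff b m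

𝟘 𝟙 : Laurent
𝟘 = []
𝟙 = [ (0ℤ , 1ℤ) ]

scale : ℤ × ℤ → Laurent → Laurent
scale (i , c) = map λ (j , d) → (i ℤ.+ j , c ℤ.* d)

infixl 6 _⊕_
infixl 7 _⊗_

_⊕_ _⊗_ : Laurent → Laurent → Laurent
a ⊕ b = a ++ b
[]      ⊗ b = []
(t ∷ a) ⊗ b = scale t b ⊕ a ⊗ b

neg : Laurent → Laurent
neg = scale (0ℤ , -1ℤ)

------------------------------------------------------------------------
-- Formal power series in q whose coefficients are Laurent polynomials in z

Series : Set
Series = ℕ → Laurent

-- z^[ i ]q^[ j ] is the series zⁱ qʲ.
z^[_]q^[_] : ℤ → ℕ → Series
z^[ i ]q^[ j ] n = if does (n ≟ j) then [ (i , 1ℤ) ] else 𝟘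

one : Series
one = z^[ 0ℤ ]q^[ 0 ]

minus : Series → Series
minus f n = neg (f n)

infixl 6 _-ₛ_
infixl 7 _*ₛ_ _/ₛ_
infixr 8 _^ₛ_

_-ₛ_ : Series → Series → Series
(f -ₛ g) n = f n ⊕ neg (g n)

-- The Cauchy product: f₀ gₙ + f₁ gₙ₋₁ + … + fₙ g₀.
_*ₛ_ : Series → Series → Series
(f *ₛ g) zero    = f 0 ⊗ g 0
(f *ₛ g) (suc n) = f 0 ⊗ g (suc n) ⊕ ((f ∘ suc) *ₛ g) n

_^ₛ_ : Series → ℕ → Series
f ^ₛ zero  = one
f ^ₛ suc k = f *ₛ f ^ₛ k

-- The inverse h of a series g with constant coefficient 1 is given by h₀ = 1
-- and hₙ₊₁ = - (g₁ hₙ + g₂ hₙ₋₁ + … + gₙ₊₁ h₀); see recip-inverseʳ.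
-- recips g n is the list hₙ , hₙ₋₁ , … , h₀.
dot : Series → List Laurent → Laurent
dot f []       = 𝟘
dot f (h ∷ hs) = f 0 ⊗ h ⊕ dot (f ∘ suc) hs

next : Series → List Laurent → Laurent
next g hs = neg (dot (g ∘ suc) hs)

recips : Series → ℕ → List Laurent
recips g zero    = [ 𝟙 ]
recips g (suc n) = next g (recips g n) ∷ recips g n

recip : Series → Series
recip g zero    = 𝟙
recip g (suc n) = next g (recips g n)

_/ₛ_ : Series → Series → Series
f /ₛ g = f *ₛ recip g

-- ⟨ a ⨾ p ⟩ N is the product of the factors 1 - a pᵏ with 0 ≤ k < N.
⟨_⨾_⟩ : Series → Series → ℕ → Series
⟨ a ⨾ p ⟩ zero    = one
⟨ a ⨾ p ⟩ (suc N) = ⟨ a ⨾ p ⟩ N *ₛ (one -ₛ a *ₛ p ^ₛ N)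

-- The infinite product, i.e. the coefficientwise limit of ⟨ a ⨾ p ⟩ N, for p
-- with zero constant coefficient: the factors with k > n do not affect the
-- coefficient of qⁿ; see ⟨⨾⟩-limit.
⟨_⨾_⟩∞ : Series → Series → Series
⟨ a ⨾ p ⟩∞ n = ⟨ a ⨾ p ⟩ (suc n) n

q q² zq² z⁻¹q² : Series
q     = z^[ 0ℤ ]q^[ 1 ]
q²    = z^[ 0ℤ ]q^[ 2 ]
zq²   = z^[ 1ℤ ]q^[ 2 ]
z⁻¹q² = z^[ -1ℤ ]q^[ 2 ]

M2-numerator M2-denominator M2-series : Series
M2-numerator   = ⟨ minus q ⨾ q ⟩∞ *ₛ ⟨ q² ⨾ q² ⟩∞
M2-denominator = ⟨ q ⨾ q² ⟩∞ *ₛ ⟨ zq² ⨾ q² ⟩∞ *ₛ ⟨ z⁻¹q² ⨾ q² ⟩∞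
M2-series      = M2-numerator /ₛ M2-denominator

M2 : ℤ → ℕ → ℤ
M2 m n = coeff (M2-series n) m

------------------------------------------------------------------------
-- Laws used to check the definitions of the quotient and infinite product

term : ℤ × ℤ → ℤ → ℤ
term (i , c) m = if does (i ℤ.≟ m) then c else 0ℤ

coeff-⊕ : ∀ a b m → coeff (a ⊕ b) m ≡ coeff a m ℤ.+ coeff b m
coeff-⊕ []            b m = sym (ℤₚ.+-identityˡ _)
coeff-⊕ (t ∷ a) b m =
  trans (cong (ℤ._+_ (term t m)) (coeff-⊕ a b m)) (sym (ℤₚ.+-assoc (term t m) _ _))

term-scale : ∀ i c j d m →
             term (i ℤ.+ j , c ℤ.* d) m ≡ c ℤ.* term (j , d) (m ℤ.- i)
term-scale i c j d m with i ℤ.+ j ℤ.≟ m | j ℤ.≟ m ℤ.- i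
... | yes _ | yes _ = refl
... | no  _ | no  _ = sym (ℤₚ.*-zeroʳ c)
... | yes p | no ¬p = contradiction (trans (lemma i j) (cong (ℤ._- i) p)) ¬p
  where
  lemma : ∀ i j → j ≡ i ℤ.+ j ℤ.- i
  lemma = solve-∀
... | no ¬p | yes p = contradiction (trans (cong (ℤ._+_ i) p) (lemma i m)) ¬p
  where
  lemma : ∀ i m → i ℤ.+ (m ℤ.- i) ≡ m
  lemma = solve-∀

coeff-scale : ∀ i c b m → coeff (scale (i , c) b) m ≡ c ℤ.* coeff b (m ℤ.- i)
coeff-scale i c []            m = sym (ℤₚ.*-zeroʳ c)
coeff-scale i c ((j , d) ∷ b) m =
  trans (cong₂ ℤ._+_ (term-scale i c j d m) (coeff-scale i c b m))
        (sym (ℤₚ.*-distribˡ-+ c (term (j , d) (m ℤ.- i)) _))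

coeff-neg : ∀ a m → coeff (neg a) m ≡ ℤ.- coeff a m
coeff-neg a m =
  trans (coeff-scale 0ℤ -1ℤ a m)
        (trans (ℤₚ.-1*i≡-i _) (cong (λ k → ℤ.- coeff a k) (ℤₚ.+-identityʳ m)))

⊕-cong : ∀ a a′ b b′ → a ≈ a′ → b ≈ b′ → a ⊕ b ≈ a′ ⊕ b′
⊕-cong a a′ b b′ p r m =
  trans (coeff-⊕ a b m) (trans (cong₂ ℤ._+_ (p m) (r m)) (sym (coeff-⊕ a′ b′ m)))

scale-cong : ∀ t b b′ → b ≈ b′ → scale t b ≈ scale t b′
scale-cong (i , c) b b′ p m =
  trans (coeff-scale i c b m)
        (trans (cong (ℤ._*_ c) (p (m ℤ.- i))) (sym (coeff-scale i c b′ m)))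

⊗-congʳ : ∀ a b b′ → b ≈ b′ → a ⊗ b ≈ a ⊗ b′
⊗-congʳ []      b b′ p m = refl
⊗-congʳ (t ∷ a) b b′ p   =
  ⊕-cong (scale t b) (scale t b′) (a ⊗ b) (a ⊗ b′)
    (scale-cong t b b′ p) (⊗-congʳ a b b′ p)

⊗-∷ʳ : ∀ a t b → a ⊗ (t ∷ b) ≈ scale t a ⊕ a ⊗ b
⊗-∷ʳ []              t         b m = refl
⊗-∷ʳ (s@(i , c) ∷ a) t@(j , d) b m = begin
  coeff (u ∷ scale s b ⊕ a ⊗ (t ∷ b)) m
    ≡⟨ cong (ℤ._+_ (term u m)) (coeff-⊕ (scale s b) _ m) ⟩
  term u m ℤ.+ (coeff (scale s b) m ℤ.+ coeff (a ⊗ (t ∷ b)) m)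
    ≡⟨ cong (λ x → term u m ℤ.+ (coeff (scale s b) m ℤ.+ x))
         (trans (⊗-∷ʳ a t b m) (coeff-⊕ (scale t a) _ m)) ⟩
  term u m ℤ.+ (coeff (scale s b) m ℤ.+ (coeff (scale t a) m ℤ.+ coeff (a ⊗ b) m))
    ≡⟨ cong₂ ℤ._+_ (cong (λ x → term x m) (cong₂ _,_ (ℤₚ.+-comm i j) (ℤₚ.*-comm c d)))
         (swap (coeff (scale s b) m) (coeff (scale t a) m) (coeff (a ⊗ b) m)) ⟩
  term v m ℤ.+ (coeff (scale t a) m ℤ.+ (coeff (scale s b) m ℤ.+ coeff (a ⊗ b) m))
    ≡⟨ cong (λ x → term v m ℤ.+ (coeff (scale t a) m ℤ.+ x)) (coeff-⊕ (scale s b) _ m) ⟨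
  term v m ℤ.+ (coeff (scale t a) m ℤ.+ coeff (scale s b ⊕ a ⊗ b) m)
    ≡⟨ cong (ℤ._+_ (term v m)) (coeff-⊕ (scale t a) _ m) ⟨
  coeff (v ∷ scale t a ⊕ (scale s b ⊕ a ⊗ b)) m ∎
  where
  open ≡-Reasoning
  u v : ℤ × ℤ
  u = i ℤ.+ j , c ℤ.* d
  v = j ℤ.+ i , d ℤ.* c
  swap : ∀ x y w → x ℤ.+ (y ℤ.+ w) ≡ y ℤ.+ (x ℤ.+ w)
  swap = solve-∀

⊗-zeroʳ : ∀ a → a ⊗ 𝟘 ≈ 𝟘
⊗-zeroʳ []      m = refl
⊗-zeroʳ (t ∷ a) m = ⊗-zeroʳ a m

⊗-comm : ∀ a b → a ⊗ b ≈ b ⊗ a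
⊗-comm a []      m = ⊗-zeroʳ a m
⊗-comm a (t ∷ b) m =
  trans (⊗-∷ʳ a t b m)
        (⊕-cong (scale t a) (scale t a) (a ⊗ b) (b ⊗ a) (λ _ → refl) (⊗-comm a b) m)

⊗-congˡ : ∀ a a′ b → a ≈ a′ → a ⊗ b ≈ a′ ⊗ b
⊗-congˡ a a′ b p m =
  trans (⊗-comm a b m) (trans (⊗-congʳ b a a′ p m) (⊗-comm b a′ m))

⊗-identityˡ : ∀ a → 𝟙 ⊗ a ≈ a
⊗-identityˡ a m =
  trans (coeff-⊕ (scale (0ℤ , 1ℤ) a) [] m)
        (trans (ℤₚ.+-identityʳ _)
               (trans (coeff-scale 0ℤ 1ℤ a m)
                      (trans (ℤₚ.*-identityˡ _) (cong (coeff a) (ℤₚ.+-identityʳ m)))))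

⊗-identityʳ : ∀ a → a ⊗ 𝟙 ≈ a
⊗-identityʳ a m = trans (⊗-comm a 𝟙 m) (⊗-identityˡ a m)

dot-recips : ∀ f g n → dot f (recips g n) ≈ (f *ₛ recip g) n
dot-recips f g zero    m =
  trans (coeff-⊕ (f 0 ⊗ 𝟙) 𝟘 m) (ℤₚ.+-identityʳ _)
dot-recips f g (suc n) =
  ⊕-cong (f 0 ⊗ h) (f 0 ⊗ h) (dot (f ∘ suc) (recips g n)) (((f ∘ suc) *ₛ recip g) n)
    (λ _ → refl) (dot-recips (f ∘ suc) g n)
  where
  h : Laurent
  h = recip g (suc n)

recip-inverseʳ : ∀ g → g 0 ≈ 𝟙 → ∀ n → (g *ₛ recip g) n ≈ one n
recip-inverseʳ g g₀≈1 zero    m = trans (⊗-identityʳ (g 0) m) (g₀≈1 m)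
recip-inverseʳ g g₀≈1 (suc n) m = begin
  coeff (g 0 ⊗ h ⊕ ((g ∘ suc) *ₛ recip g) n) m
    ≡⟨ coeff-⊕ (g 0 ⊗ h) _ m ⟩
  coeff (g 0 ⊗ h) m ℤ.+ coeff (((g ∘ suc) *ₛ recip g) n) m
    ≡⟨ cong₂ ℤ._+_
         (trans (⊗-congˡ (g 0) 𝟙 h g₀≈1 m) (trans (⊗-identityˡ h m) (coeff-neg d m)))
         (sym (dot-recips (g ∘ suc) g n m)) ⟩
  ℤ.- coeff d m ℤ.+ coeff d m
    ≡⟨ ℤₚ.+-inverseˡ (coeff d m) ⟩
  0ℤ ∎
  where
  open ≡-Reasoning
  d h : Laurent
  d = dot (g ∘ suc) (recips g n)
  h = neg d

VanishesBelow : ℕ → Series → Set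
VanishesBelow k f = ∀ i → i < k → f i ≈ 𝟘

⊕-zero : ∀ a b → a ≈ 𝟘 → b ≈ 𝟘 → a ⊕ b ≈ 𝟘
⊕-zero a b = ⊕-cong a 𝟘 b 𝟘

⊗-vanishesʳ : ∀ a b → b ≈ 𝟘 → a ⊗ b ≈ 𝟘
⊗-vanishesʳ a b p m = trans (⊗-congʳ a b 𝟘 p m) (⊗-zeroʳ a m)

⊗-vanishesˡ : ∀ a b → a ≈ 𝟘 → a ⊗ b ≈ 𝟘
⊗-vanishesˡ a b = ⊗-congˡ a 𝟘 b

*ₛ-vanishesʳ : ∀ k f g → VanishesBelow k g → VanishesBelow k (f *ₛ g)
*ₛ-vanishesʳ k f g v zero    0<k   = ⊗-vanishesʳ (f 0) (g 0) (v 0 0<k)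
*ₛ-vanishesʳ k f g v (suc i) 1+i<k =
  ⊕-zero (f 0 ⊗ g (suc i)) (((f ∘ suc) *ₛ g) i)
    (⊗-vanishesʳ (f 0) (g (suc i)) (v (suc i) 1+i<k))
    (*ₛ-vanishesʳ k (f ∘ suc) g v i (ℕₚ.<-trans (ℕₚ.n<1+n i) 1+i<k))

^ₛ-vanishes : ∀ p → p 0 ≈ 𝟘 → ∀ k → VanishesBelow k (p ^ₛ k)
^ₛ-vanishes p p₀≈0 (suc k) zero    _         = ⊗-vanishesˡ (p 0) ((p ^ₛ k) 0) p₀≈0
^ₛ-vanishes p p₀≈0 (suc k) (suc i) (s≤s i<k) =
  ⊕-zero (p 0 ⊗ (p ^ₛ k) (suc i)) (((p ∘ suc) *ₛ p ^ₛ k) i)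
    (⊗-vanishesˡ (p 0) ((p ^ₛ k) (suc i)) p₀≈0)
    (*ₛ-vanishesʳ k (p ∘ suc) (p ^ₛ k) (^ₛ-vanishes p p₀≈0 k) i i<k)

neg-vanishes : ∀ a → a ≈ 𝟘 → neg a ≈ 𝟘
neg-vanishes a p m = trans (coeff-neg a m) (cong ℤ.-_ (p m))

*ₛ-trivial-factor : ∀ f x n → VanishesBelow (suc n) x → (f *ₛ (one -ₛ x)) n ≈ f n
*ₛ-trivial-factor f x zero    v m =
  trans (⊗-congʳ (f 0) ((one -ₛ x) 0) 𝟙
          (⊕-cong 𝟙 𝟙 (neg (x 0)) 𝟘 (λ _ → refl) (neg-vanishes (x 0) (v 0 (s≤s z≤n)))) m)
        (⊗-identityʳ (f 0) m)
*ₛ-trivial-factor f x (suc n) v =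
  ⊕-cong (f 0 ⊗ (one -ₛ x) (suc n)) 𝟘 (((f ∘ suc) *ₛ (one -ₛ x)) n) (f (suc n))
    (⊗-vanishesʳ (f 0) ((one -ₛ x) (suc n))
      (neg-vanishes (x (suc n)) (v (suc n) ℕₚ.≤-refl)))
    (*ₛ-trivial-factor (f ∘ suc) x n (λ i i<1+n → v i (ℕₚ.m<n⇒m<1+n i<1+n)))

⟨⨾⟩-limit : ∀ a p → p 0 ≈ 𝟘 → ∀ n j → ⟨ a ⨾ p ⟩ (j + suc n) n ≈ ⟨ a ⨾ p ⟩∞ n
⟨⨾⟩-limit a p p₀≈0 n zero    m = refl
⟨⨾⟩-limit a p p₀≈0 n (suc j) m =
  trans (*ₛ-trivial-factor (⟨ a ⨾ p ⟩ N) (a *ₛ p ^ₛ N) n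
          (*ₛ-vanishesʳ (suc n) a (p ^ₛ N)
            (λ i i<1+n → ^ₛ-vanishes p p₀≈0 N i
                           (ℕₚ.<-≤-trans i<1+n (ℕₚ.m≤n+m (suc n) j)))) m)
        (⟨⨾⟩-limit a p p₀≈0 n j m)
  where
  N : ℕ
  N = j + suc n

M2-denominator-inverse : ∀ n → (M2-denominator *ₛ recip M2-denominator) n ≈ one n
M2-denominator-inverse = recip-inverseʳ M2-denominator (λ _ → refl)

{-# OPTIONS --safe #-}

-- Write p = q², and let (a ; p)ₙ be the product of the 1 - a pᵏ with k < n.
-- The factor π₃ contributes 1 / (q ; p)∞ on both sides, so only π₁ and π₂ matter.
-- Classifying the non-empty π₂ / 2 without ones by its largest part L and the
-- others by the number j of ones gives the generating function
--   C = Σ_{L ≥ 2} (zp)ᴸ (1 - p) / (p ; p)_L  +  Σ_{j ≥ 1} (z⁻¹p)ʲ (1 - p) / ((p ; p)ⱼ (zpʲ⁺¹ ; p)∞)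
-- of the crank.  Both sums are evaluated by the q-binomial theorem, whence
--   C + 1 + (z - 1) p = (p ; p)∞ / ((zp ; p)∞ (z⁻¹p ; p)∞).
-- The partitions π₁ ≠ ∅ with κ π₁ = 1 arise from the partitions into distinct
-- parts by adding 2 to the largest part, the partition 2 arising from ∅.  So the
-- overpartitions with π₂ = ∅ supply exactly the missing term: setting κ ∅ = 0,
--   Σ z^κ(π₁) q^|π₁| = (1 + (z - 1) p) (-q ; q)∞.
module Submission where

open import Algebra using (CommutativeRing)
open import Data.Integer as ℤ using (ℤ; +_; 0ℤ; 1ℤ; -1ℤ; _⊖_)
import Data.Integer.Properties as ℤₚ
open import Data.List using (List; []; _∷_; [_]; _++_; map; replicate; filter; length; lookup; cartesianProduct)
open import Data.List.Properties using (++-assoc; ++-identityʳ)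
open import Data.Nat as ℕ using (ℕ; zero; suc; pred; _≤_; _<_; _≥_; z≤n; s≤s; _≟_; _<?_)
import Data.Nat.Properties as ℕₚ
open import Data.Product using (_×_; _,_; proj₁; proj₂; ∃-syntax)
open import Function using (_∘_)
open import Level using (0ℓ)
open import Relation.Binary.PropositionalEquality as ≡ using (_≡_; _≢_)

-- The q-binomial theorem and the crank

-- The two sums in `C` interlock. The first lacks its terms for `L = 0` and `L = 1`, which are
-- `1 - p` and `zp`; with them Euler's identity evaluates it to `(1 - p) / (zp ; p)∞`. Multiplied by
-- `(zp ; p)∞`, the second sum has the terms `(z⁻¹p)ʲ (1 - p) (zp ; p)ⱼ / (p ; p)ⱼ` with `j ≥ 1`,
-- and the term missing at `j = 0` is exactly the value `1 - p` left by the first. The q-binomial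
-- theorem with `a = zp` and `t = z⁻¹p` then yields `(1 - p) (p² ; p)∞ / (z⁻¹p ; p)∞`, since
-- `z z⁻¹ = 1`. The obstacles are division and convergence. The algebra therefore lives in an
-- arbitrary commutative ring: a quotient enters only through the recurrence of the partitions that
-- it counts, and a limit only through the vanishing of a power of `p`. The enumerations of
-- partitions are built by the same recurrences, so that each generating function satisfies its
-- recurrence by construction.

module QAlgebra {c ℓ} (R : CommutativeRing c ℓ) where
  open CommutativeRing R
  open import Algebra.Properties.Ring ring
    using (-‿distribˡ-*; -‿involutive; -0#≈0#; +-cancelʳ)
  open import Algebra.Properties.Semiring.Exp semiring using (_^_; ^-congˡ; ^-homo-*)
  open import Algebra.Properties.CommutativeSemiring.Exp commutativeSemiring using (^-distrib-*)
  open import Algebra.Solver.Ring.NaturalCoefficients.Default commutativeSemiring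
    using (solve; _:=_; _:+_; _:*_; con)
  open import Relation.Binary.Reasoning.Setoid setoid

  1-_ : Carrier → Carrier
  1- x = 1# - x

  poch : Carrier → Carrier → ℕ → Carrier
  poch a p zero    = 1#
  poch a p (suc n) = poch a p n * (1- (a * p ^ n))

  1-‿cong : ∀ {x y} → x ≈ y → 1- x ≈ 1- y
  1-‿cong p = +-congˡ (-‿cong p)

  1-0≈1 : ∀ {x} → x ≈ 0# → 1- x ≈ 1#
  1-0≈1 p = trans (1-‿cong p) (trans (+-congˡ -0#≈0#) (+-identityʳ 1#))

  1-x+x≈1 : ∀ x → 1- x + x ≈ 1#
  1-x+x≈1 x = trans (+-assoc 1# (- x) x) (trans (+-congˡ (-‿inverseˡ x)) (+-identityʳ 1#))

  *-1- : ∀ a x → a * (1- x) ≈ a - x * a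
  *-1- a x = begin
    a * (1- x)        ≈⟨ distribˡ a 1# (- x) ⟩
    a * 1# + a * - x  ≈⟨ +-cong (*-identityʳ a) (trans (*-comm a (- x)) (sym (-‿distribˡ-* x a))) ⟩
    a - x * a         ∎

  1-x+[1-b]x≈1-bx : ∀ x b → 1- x + (1- b) * x ≈ 1- (b * x)
  1-x+[1-b]x≈1-bx x b = begin
    1- x + (1- b) * x    ≈⟨ +-congˡ (trans (*-comm (1- b) x) (*-1- x b)) ⟩
    1- x + (x - b * x)   ≈⟨ +-assoc (1- x) x _ ⟨
    1- x + x - b * x     ≈⟨ +-congʳ (1-x+x≈1 x) ⟩
    1- (b * x)           ∎

  poch-cong : ∀ {a b} p n → a ≈ b → poch a p n ≈ poch b p n
  poch-cong p zero    a≈b = refl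
  poch-cong p (suc n) a≈b = *-cong (poch-cong p n a≈b) (1-‿cong (*-congʳ a≈b))

  poch-0 : ∀ {a} p n → a ≈ 0# → poch a p n ≈ 1#
  poch-0 p zero    a≈0 = refl
  poch-0 {a} p (suc n) a≈0 = trans
    (*-cong (poch-0 p n a≈0) (1-0≈1 (trans (*-congʳ a≈0) (zeroˡ (p ^ n))))) (*-identityʳ 1#)

  poch-sucˡ : ∀ a p n → (1- a) * poch (a * p) p n ≈ poch a p (suc n)
  poch-sucˡ a p zero    = begin
    (1- a) * 1#         ≈⟨ *-comm (1- a) 1# ⟩
    1# * (1- a)         ≈⟨ *-congˡ (1-‿cong (*-identityʳ a)) ⟨
    1# * (1- (a * 1#))  ∎
  poch-sucˡ a p (suc n) = begin
    (1- a) * (poch (a * p) p n * (1- (a * p * p ^ n)))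
      ≈⟨ *-assoc _ _ _ ⟨
    (1- a) * poch (a * p) p n * (1- (a * p * p ^ n))
      ≈⟨ *-cong (poch-sucˡ a p n) (1-‿cong (*-assoc a p (p ^ n))) ⟩
    poch a p (suc n) * (1- (a * (p * p ^ n))) ∎

  poch-suc≈ : ∀ a p n → a * p ^ n ≈ 0# → poch a p (suc n) ≈ poch a p n
  poch-suc≈ a p n ap≈0 = trans (*-congˡ (1-0≈1 ap≈0)) (*-identityʳ _)

  -- The recurrence says that one more copy of a part of weight `x` may be added; this consequence
  -- replaces division by `1 - x`.
  geometric-* : ∀ {a u x} → a ≈ u + x * a → a * (1- x) ≈ u
  geometric-* {a} {u} {x} eq = begin
    a * (1- x)             ≈⟨ *-1- a x ⟩
    a - x * a              ≈⟨ +-congʳ eq ⟩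
    u + x * a - x * a      ≈⟨ +-assoc u _ _ ⟩
    u + (x * a - x * a)    ≈⟨ +-congˡ (-‿inverseʳ (x * a)) ⟩
    u + 0#                 ≈⟨ +-identityʳ u ⟩
    u                      ∎

  private
    partial : Carrier → Carrier → ℕ → Carrier
    partial u x zero    = 0#
    partial u x (suc n) = u + x * partial u x n

    unroll : ∀ {a u x} n → a ≈ u + x * a → a ≈ partial u x n + x ^ n * a
    unroll {a} {u} {x} zero    eq = sym (trans (+-identityˡ _) (*-identityˡ a))
    unroll {a} {u} {x} (suc n) eq = begin
      a                                          ≈⟨ eq ⟩
      u + x * a                                  ≈⟨ +-congˡ (*-congˡ (unroll n eq)) ⟩
      u + x * (partial u x n + x ^ n * a)
        ≈⟨ solve 5 (λ a u x s y → u :+ x :* (s :+ y :* a) := u :+ x :* s :+ x :* y :* a) refl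
             a u x (partial u x n) (x ^ n) ⟩
      u + x * partial u x n + x * x ^ n * a      ∎

  -- Unrolling `n` times leaves a remainder with factor `x ^ n`, which vanishes. This takes the
  -- place of cancelling `1 - x`.
  geometric-unique : ∀ {a b u x} n → x ^ n ≈ 0# → a ≈ u + x * a → b ≈ u + x * b → a ≈ b
  geometric-unique {a} {b} {u} {x} n xⁿ≈0 p r = trans (step p) (sym (step r))
    where
    step : ∀ {d} → d ≈ u + x * d → d ≈ partial u x n
    step {d} eq = begin
      d                            ≈⟨ unroll n eq ⟩
      partial u x n + x ^ n * d    ≈⟨ +-congˡ (trans (*-congʳ xⁿ≈0) (zeroˡ d)) ⟩
      partial u x n + 0#           ≈⟨ +-identityʳ _ ⟩
      partial u x n                ∎

  ^-zero-≤ : ∀ {x m n} → m ≤ n → x ^ m ≈ 0# → x ^ n ≈ 0#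
  ^-zero-≤ {x} {zero}  {n}     _         1≈0 =
    trans (sym (*-identityˡ _)) (trans (*-congʳ 1≈0) (zeroˡ _))
  ^-zero-≤ {x} {suc m} {suc n} (s≤s m≤n) x^≈0 = begin
    x ^ suc n                     ≡⟨ ≡.cong (x ^_) (ℕₚ.m+[n∸m]≡n (s≤s m≤n)) ⟨
    x ^ (suc m ℕ.+ (n ℕ.∸ m))     ≈⟨ ^-homo-* x (suc m) (n ℕ.∸ m) ⟩
    x ^ suc m * x ^ (n ℕ.∸ m)     ≈⟨ trans (*-congʳ x^≈0) (zeroˡ _) ⟩
    0#                            ∎

  *-^-zero : ∀ a {x n} → x ^ n ≈ 0# → (a * x) ^ n ≈ 0#
  *-^-zero a {x} {n} x^≈0 = trans (^-distrib-* a x n) (trans (*-congˡ x^≈0) (zeroʳ _))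

  -- Truncated power series and the q-binomial theorem

  psum : (ℕ → Carrier) → Carrier → ℕ → Carrier
  psum c t zero    = c 0
  psum c t (suc J) = psum c t J + c (suc J) * t ^ suc J

  psum-cong : ∀ c {t u} J → t ≈ u → psum c t J ≈ psum c u J
  psum-cong c zero    t≈u = refl
  psum-cong c (suc J) t≈u = +-cong (psum-cong c J t≈u) (*-congˡ (^-congˡ (suc J) t≈u))

  psum-0 : ∀ c {t} J → t ≈ 0# → psum c t J ≈ c 0
  psum-0 c     zero    t≈0 = refl
  psum-0 c {t} (suc J) t≈0 = begin
    psum c t J + c (suc J) * (t * t ^ J)
      ≈⟨ +-cong (psum-0 c J t≈0) (*-congˡ (trans (*-congʳ t≈0) (zeroˡ _))) ⟩
    c 0 + c (suc J) * 0#    ≈⟨ +-congˡ (zeroʳ _) ⟩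
    c 0 + 0#                ≈⟨ +-identityʳ _ ⟩
    c 0                     ∎

  module QBinomial (p a : Carrier) (c : ℕ → Carrier)
    (ratio : ∀ j → c (suc j) * (1- (p ^ suc j)) ≈ c j * (1- (a * p ^ j))) where

    -- For an untruncated series `F` the ratio condition gives `F(t) - F(pt) = t F(t) - a t F(pt)`,
    -- hence `(1 - t) F(t) = (1 - at) F(pt)`. Truncation leaves the boundary term of degree `J + 1`.
    functional-equation : ∀ t J →
      (1- t) * psum c t J + c J * (1- (a * p ^ J)) * t ^ suc J ≈ (1- (a * t)) * psum c (p * t) J
    functional-equation t zero = begin
      (1- t) * c 0 + c 0 * (1- (a * 1#)) * (t * 1#)
        ≈⟨ solve 4 (λ u v c t → u :* c :+ c :* v :* (t :* con 1) := (u :+ v :* t) :* c) refl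
             (1- t) (1- (a * 1#)) (c 0) t ⟩
      (1- t + (1- (a * 1#)) * t) * c 0
        ≈⟨ *-congʳ (1-x+[1-b]x≈1-bx t (a * 1#)) ⟩
      (1- (a * 1# * t)) * c 0
        ≈⟨ *-congʳ (1-‿cong (*-congʳ (*-identityʳ a))) ⟩
      (1- (a * t)) * c 0 ∎
    functional-equation t (suc J) = begin
      (1- t) * (F + C * T) + C * (1- (a * P)) * (t * T)
        ≈⟨ solve 6 (λ u v F C T t → u :* (F :+ C :* T) :+ C :* v :* (t :* T)
                                      := u :* F :+ C :* T :* (u :+ v :* t)) refl
             (1- t) (1- (a * P)) F C T t ⟩
      (1- t) * F + C * T * (1- t + (1- (a * P)) * t)
        -- `1 - a P t` splits symmetrically with respect to `t` and to `P`; passing from one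
        -- splitting to the other exposes the factor `1 - P` that `ratio` absorbs.
        ≈⟨ +-congˡ (*-congˡ (begin
             1- t + (1- (a * P)) * t    ≈⟨ 1-x+[1-b]x≈1-bx t (a * P) ⟩
             1- (a * P * t)
               ≈⟨ 1-‿cong (solve 3 (λ a P t → a :* P :* t := a :* t :* P) refl a P t) ⟩
             1- (a * t * P)             ≈⟨ 1-x+[1-b]x≈1-bx P (a * t) ⟨
             1- P + (1- (a * t)) * P    ∎)) ⟩
      (1- t) * F + C * T * (1- P + (1- (a * t)) * P)
        ≈⟨ solve 6 (λ f C T u v P → f :+ C :* T :* (u :+ v :* P)
                                      := f :+ C :* u :* T :+ v :* (C :* (P :* T))) refl
             ((1- t) * F) C T (1- P) (1- (a * t)) P ⟩
      (1- t) * F + C * (1- P) * T + (1- (a * t)) * (C * (P * T))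
        ≈⟨ +-cong (trans (+-congˡ (*-congʳ (ratio J))) (functional-equation t J))
                  (*-congˡ (*-congˡ (sym (^-distrib-* p t (suc J))))) ⟩
      (1- (a * t)) * psum c (p * t) J + (1- (a * t)) * (C * (p * t) ^ suc J)
        ≈⟨ distribˡ _ _ _ ⟨
      (1- (a * t)) * psum c (p * t) (suc J) ∎
      where
      F = psum c t J
      C = c (suc J)
      T = t ^ suc J
      P = p ^ suc J

    -- The functional equation is applied at `t`, `t p`, `t p ^ 2` and so on; each of these
    -- arguments inherits nilpotency from `t`, so the boundary term is always zero.
    iterate : ∀ t J → t ^ suc J ≈ 0# → ∀ n →
              poch t p n * psum c t J ≈ poch (a * t) p n * psum c (t * p ^ n) J
    iterate t J t^≈0 zero    = *-congˡ (psum-cong c J (sym (*-identityʳ t)))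
    iterate t J t^≈0 (suc n) = begin
      poch t p n * (1- s) * psum c t J
        ≈⟨ solve 3 (λ x y z → x :* y :* z := y :* (x :* z)) refl (poch t p n) (1- s) (psum c t J) ⟩
      (1- s) * (poch t p n * psum c t J)
        ≈⟨ *-congˡ (iterate t J t^≈0 n) ⟩
      (1- s) * (poch (a * t) p n * psum c s J)
        ≈⟨ solve 3 (λ x y z → y :* (x :* z) := x :* (y :* z)) refl
             (poch (a * t) p n) (1- s) (psum c s J) ⟩
      poch (a * t) p n * ((1- s) * psum c s J)
        ≈⟨ *-congˡ (begin
             (1- s) * psum c s J          ≈⟨ +-identityʳ _ ⟨
             (1- s) * psum c s J + 0#     ≈⟨ +-congˡ (trans (*-congˡ s^≈0) (zeroʳ _)) ⟨
             (1- s) * psum c s J + c J * (1- (a * p ^ J)) * s ^ suc J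
                                          ≈⟨ functional-equation s J ⟩
             (1- (a * s)) * psum c (p * s) J
               ≈⟨ *-cong (1-‿cong (sym (*-assoc a t _)))
                    (psum-cong c J (solve 3 (λ p t q → p :* (t :* q) := t :* (p :* q)) refl
                                      p t (p ^ n))) ⟩
             (1- (a * t * p ^ n)) * psum c (t * p ^ suc n) J ∎) ⟩
      poch (a * t) p n * ((1- (a * t * p ^ n)) * psum c (t * p ^ suc n) J)
        ≈⟨ *-assoc _ _ _ ⟨
      poch (a * t) p (suc n) * psum c (t * p ^ suc n) J ∎
      where
      s = t * p ^ n
      s^≈0 : s ^ suc J ≈ 0#
      s^≈0 = trans (^-congˡ (suc J) (*-comm t (p ^ n))) (*-^-zero (p ^ n) {t} {suc J} t^≈0)

    -- Once `p ^ n` vanishes, the iterated argument is zero and only the constant term of the series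
    -- survives.
    q-binomial : ∀ t J n → t ^ suc J ≈ 0# → p ^ n ≈ 0# →
                 poch t p n * psum c t J ≈ poch (a * t) p n * c 0
    q-binomial t J n t^≈0 p^≈0 = trans (iterate t J t^≈0 n)
      (*-congˡ (psum-0 c J (trans (*-congˡ p^≈0) (zeroʳ t))))

  -- U K is the generating function of partitions into parts 2, …, K + 1, and
  -- W j H that of partitions with j + 1 ones and other parts in 2, …, H + 1,
  -- where z marks the crank.
  module Crank (p z z⁻¹ : Carrier) (H : ℕ) (p^≈0 : p ^ H ≈ 0#) (zz⁻¹≈1 : z * z⁻¹ ≈ 1#)
    (U N O : ℕ → Carrier) (W : ℕ → ℕ → Carrier)
    (U-zero : U 0 ≈ 1#)
    (U-suc  : ∀ K → U (suc K) ≈ U K + p ^ suc (suc K) * U (suc K))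
    (W-zero : ∀ j → W j 0 ≈ (z⁻¹ * p) ^ suc j)
    -- The part `K + 2` counts towards `μ`, and so carries a `z`, only if it exceeds the number
    -- `j + 1` of ones, that is, if `j ≤ K`.
    (W-small : ∀ j K → K < j → W j (suc K) ≈ W j K + p ^ suc (suc K) * W j (suc K))
    (W-large : ∀ j K → j ≤ K → W j (suc K) ≈ W j K + (z * p) * p ^ suc K * W j (suc K))
    (N-zero : N 0 ≈ 0#)
    (N-suc  : ∀ K → N (suc K) ≈ N K + (z * p) ^ suc (suc K) * U (suc K))
    (O-zero : O 0 ≈ 0#)
    (O-suc  : ∀ j → O (suc j) ≈ O j + W j H)
    where

    private
      n : ℕ
      n = suc H
      x y : Carrier
      x = z * p
      y = z⁻¹ * p

      p^n≈0 : p ^ n ≈ 0#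
      p^n≈0 = ^-zero-≤ (ℕₚ.n≤1+n H) p^≈0

      -- V j is (1 - p) / (p ; p)ⱼ.
      V : ℕ → Carrier
      V zero    = 1- p
      V (suc K) = U K

      V-suc : ∀ j → V (suc j) ≈ V j + p ^ suc j * V (suc j)
      V-suc zero    = begin
        U 0                         ≈⟨ U-zero ⟩
        1#                          ≈⟨ 1-x+x≈1 p ⟨
        1- p + p
          ≈⟨ +-congˡ (trans (*-identityʳ (p * 1#)) (*-identityʳ p)) ⟨
        1- p + p * 1# * 1#          ≈⟨ +-congˡ (*-congˡ U-zero) ⟨
        1- p + p * 1# * U 0         ∎
      V-suc (suc K) = U-suc K

      V-ratio : ∀ j → V (suc j) * (1- (p ^ suc j)) ≈ V j
      V-ratio j = geometric-* (V-suc j)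

      -- Up to the factor `1 - p`, these are the q-binomial coefficients `(x ; p)ⱼ / (p ; p)ⱼ`.
      cV : ℕ → Carrier
      cV j = poch x p j * V j

      cV-ratio : ∀ j → cV (suc j) * (1- (p ^ suc j)) ≈ cV j * (1- (x * p ^ j))
      cV-ratio j = begin
        poch x p j * (1- (x * p ^ j)) * V (suc j) * (1- (p ^ suc j))
          ≈⟨ *-assoc _ _ _ ⟩
        poch x p j * (1- (x * p ^ j)) * (V (suc j) * (1- (p ^ suc j)))
          ≈⟨ *-congˡ (V-ratio j) ⟩
        poch x p j * (1- (x * p ^ j)) * V j
          ≈⟨ solve 3 (λ a b c → a :* b :* c := a :* c :* b) refl _ _ _ ⟩
        cV j * (1- (x * p ^ j)) ∎

      -- Euler's identity, which is the q-binomial theorem with `a = 0`; the right-hand side is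
      -- `V 0`.
      largest-part-sum : poch x p n * psum V x n ≈ 1- p
      largest-part-sum = trans
        (QBinomial.q-binomial p 0# V
          (λ j → trans (V-ratio j) (sym (trans (*-congˡ (1-0≈1 (zeroˡ (p ^ j)))) (*-identityʳ _))))
          x n n (*-^-zero z {p} {suc n} (^-zero-≤ (ℕₚ.n≤1+n n) p^n≈0)) p^n≈0)
        (trans (*-congʳ (poch-0 p n (zeroˡ x))) (*-identityˡ _))

      ones-sum : poch y p n * psum cV y H ≈ poch p p n
      ones-sum = begin
        poch y p n * psum cV y H
          ≈⟨ QBinomial.q-binomial p x cV cV-ratio y H n (*-^-zero z⁻¹ {p} {n} p^n≈0) p^n≈0 ⟩
        poch (x * y) p n * (1# * (1- p))
          ≈⟨ *-congʳ (poch-cong p n (begin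
               z * p * (z⁻¹ * p)    ≈⟨ solve 3 (λ z w p → z :* p :* (w :* p) := z :* w :* (p :* p))
                                         refl z z⁻¹ p ⟩
               z * z⁻¹ * (p * p)    ≈⟨ trans (*-congʳ zz⁻¹≈1) (*-identityˡ _) ⟩
               p * p                ∎)) ⟩
        poch (p * p) p n * (1# * (1- p))
          ≈⟨ solve 2 (λ a b → a :* (con 1 :* b) := b :* a) refl (poch (p * p) p n) (1- p) ⟩
        (1- p) * poch (p * p) p n
          ≈⟨ poch-sucˡ p p n ⟩
        poch p p (suc n)
          ≈⟨ poch-suc≈ p p n (trans (*-congˡ p^n≈0) (zeroʳ p)) ⟩
        poch p p n ∎

      -- A non-empty partition without ones has largest part at least 2, so the terms `V 0 = 1 - p`
      -- and `V 1 * x = x` of the series have to be added by hand.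
      N-sum : ∀ K → 1- p + x + N K ≈ psum V x (suc K)
      N-sum zero    = begin
        1- p + x + N 0                ≈⟨ +-congˡ N-zero ⟩
        1- p + x + 0#                 ≈⟨ solve 2 (λ a x → a :+ x :+ con 0 := a :+ con 1 :* (x :* con 1))
                                           refl (1- p) x ⟩
        1- p + 1# * (x * 1#)          ≈⟨ +-congˡ (*-congʳ U-zero) ⟨
        1- p + U 0 * (x * 1#)         ∎
      N-sum (suc K) = begin
        1- p + x + N (suc K)          ≈⟨ +-congˡ (N-suc K) ⟩
        1- p + x + (N K + x ^ suc (suc K) * U (suc K))
          ≈⟨ +-assoc (1- p + x) (N K) _ ⟨
        1- p + x + N K + x ^ suc (suc K) * U (suc K)
          ≈⟨ +-cong (N-sum K) (*-comm _ _) ⟩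
        psum V x (suc (suc K))        ∎

      -- No part up to `K + 1` exceeds the `j + 1` ones, so `z⁻¹` records the ones and nothing else
      -- is marked. Both sides solve the same recurrence with a nilpotent ratio.
      W-before : ∀ j K → K ≤ j → W j K ≈ y ^ suc j * U K
      W-before j zero    _   = trans (W-zero j) (sym (trans (*-congˡ U-zero) (*-identityʳ _)))
      W-before j (suc K) K<j = geometric-unique H
        (trans (^-congˡ H (*-comm p (p ^ suc K))) (*-^-zero (p ^ suc K) {p} {H} p^≈0))
        (W-small j K K<j)
        (begin
          y ^ suc j * U (suc K)
            ≈⟨ *-congˡ (U-suc K) ⟩
          y ^ suc j * (U K + p ^ suc (suc K) * U (suc K))
            ≈⟨ solve 4 (λ y u q v → y :* (u :+ q :* v) := y :* u :+ q :* (y :* v)) refl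
                 (y ^ suc j) (U K) (p ^ suc (suc K)) (U (suc K)) ⟩
          y ^ suc j * U K + p ^ suc (suc K) * (y ^ suc j * U (suc K))
            ≈⟨ +-congʳ (sym (W-before j K (ℕₚ.<⇒≤ K<j))) ⟩
          W j K + p ^ suc (suc K) * (y ^ suc j * U (suc K)) ∎)

      -- Every part larger than `j + 1` brings a denominator that cancels one factor of `poch x p`.
      -- The first `j + 1` factors meet no partner and turn `V (suc j)` into `cV (suc j)`.
      W-after : ∀ j d → W j (d ℕ.+ j) * poch x p (suc (d ℕ.+ j)) ≈ y ^ suc j * cV (suc j)
      W-after j zero    = begin
        W j j * poch x p (suc j)              ≈⟨ *-congʳ (W-before j j ℕₚ.≤-refl) ⟩
        y ^ suc j * U j * poch x p (suc j)
          ≈⟨ solve 3 (λ a b c → a :* b :* c := a :* (c :* b)) refl _ _ _ ⟩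
        y ^ suc j * cV (suc j)                ∎
      W-after j (suc d) = begin
        w * (P * (1- e))    ≈⟨ solve 3 (λ a b c → a :* (b :* c) := a :* c :* b) refl w P (1- e) ⟩
        w * (1- e) * P      ≈⟨ *-congʳ (geometric-* (W-large j (d ℕ.+ j) (ℕₚ.m≤n+m j d))) ⟩
        W j (d ℕ.+ j) * P   ≈⟨ W-after j d ⟩
        y ^ suc j * cV (suc j) ∎
        where
        w = W j (suc d ℕ.+ j)
        P = poch x p (suc (d ℕ.+ j))
        e = x * p ^ suc (d ℕ.+ j)

      O-sum : ∀ K → K ≤ H → 1- p + O K * poch x p n ≈ psum cV y K
      O-sum zero    _   = begin
        1- p + O 0 * poch x p n    ≈⟨ +-congˡ (trans (*-congʳ O-zero) (zeroˡ _)) ⟩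
        1- p + 0#                  ≈⟨ solve 1 (λ a → a :+ con 0 := con 1 :* a) refl (1- p) ⟩
        1# * (1- p)                ∎
      O-sum (suc K) K<H = begin
        1- p + O (suc K) * poch x p n
          ≈⟨ +-congˡ (trans (*-congʳ (O-suc K)) (distribʳ _ _ _)) ⟩
        1- p + (O K * poch x p n + W K H * poch x p n)
          ≈⟨ +-assoc _ _ _ ⟨
        1- p + O K * poch x p n + W K H * poch x p n
          ≈⟨ +-cong (O-sum K (ℕₚ.<⇒≤ K<H)) (begin
               W K H * poch x p (suc H)
                 ≡⟨ ≡.cong (λ h → W K h * poch x p (suc h)) (ℕₚ.m∸n+n≡m (ℕₚ.<⇒≤ K<H)) ⟨
               W K (H ℕ.∸ K ℕ.+ K) * poch x p (suc (H ℕ.∸ K ℕ.+ K))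
                 ≈⟨ W-after K (H ℕ.∸ K) ⟩
               y ^ suc K * cV (suc K)   ≈⟨ *-comm _ _ ⟩
               cV (suc K) * y ^ suc K   ∎) ⟩
        psum cV y (suc K) ∎
    
    crank-identity : (1- p + z * p + (N H + O H)) * (poch (z * p) p n * poch (z⁻¹ * p) p n)
                     ≈ poch p p n
    crank-identity = begin
      (1- p + x + (N H + O H)) * (X * Y)
        ≈⟨ solve 5 (λ b n o X Y → (b :+ (n :+ o)) :* (X :* Y) := (X :* (b :+ n) :+ o :* X) :* Y)
             refl (1- p + x) (N H) (O H) X Y ⟩
      (X * (1- p + x + N H) + O H * X) * Y
        ≈⟨ *-congʳ (+-congʳ (trans (*-congˡ (N-sum H)) largest-part-sum)) ⟩
      (1- p + O H * X) * Y
        ≈⟨ *-congʳ (O-sum H ℕₚ.≤-refl) ⟩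
      psum cV y H * Y    ≈⟨ *-comm _ _ ⟩
      Y * psum cV y H    ≈⟨ ones-sum ⟩
      poch p p n ∎
      where
      X = poch x p n
      Y = poch y p n

  -- A K is the generating function of partitions into distinct parts at most K,
  -- and G K the one in which z moreover marks κ.
  module Kappa (q z : Carrier) (A G : ℕ → Carrier)
    (A-zero : A 0 ≈ 1#)
    (A-suc  : ∀ K → A (suc K) ≈ A K + q ^ suc K * A K)
    (G-one  : G 1 ≈ A 1)
    (G-two  : G 2 ≈ G 1 + q ^ 2 * (z + q))
    (G-three : G 3 ≈ G 2 + q ^ 3 * (z + q + q ^ 2 * A 1))
    (G-suc  : ∀ K → G (4 ℕ.+ K) ≈ G (3 ℕ.+ K) +
                q ^ (4 ℕ.+ K) * (z * A (1 ℕ.+ K) + q ^ (2 ℕ.+ K) * A (1 ℕ.+ K) + q ^ (3 ℕ.+ K) * A (2 ℕ.+ K)))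
    where

    private
      A₁ : A 1 ≈ 1# + q
      A₁ = begin
        A 1                  ≈⟨ A-suc 0 ⟩
        A 0 + q * 1# * A 0   ≈⟨ +-cong A-zero (*-congˡ A-zero) ⟩
        1# + q * 1# * 1#     ≈⟨ solve 1 (λ q → con 1 :+ q :* con 1 :* con 1 := con 1 :+ q) refl q ⟩
        1# + q               ∎

      A₂ : A 2 ≈ (1# + q) + q ^ 2 * (1# + q)
      A₂ = trans (A-suc 1) (+-cong A₁ (*-congˡ A₁))

    -- Adding 2 to the largest part shows that `q ^ 2 * A K` counts the partitions with `κ = 1` and
    -- parts at most `K + 2`; their weight changes from 1 to `z`. The proof is an induction on
    -- recurrences, and `K = 0, 1` are separate because the general rule for `κ` starts at largest
    -- part 4.
    kappa-identity : ∀ K → G (2 ℕ.+ K) + q ^ 2 * A K ≈ A (2 ℕ.+ K) + z * q ^ 2 * A K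
    kappa-identity zero = begin
      G 2 + q ^ 2 * A 0
        ≈⟨ +-cong (trans G-two (+-congʳ (trans G-one A₁))) (*-congˡ A-zero) ⟩
      1# + q + q ^ 2 * (z + q) + q ^ 2 * 1#
        ≈⟨ solve 3 (λ q r z → con 1 :+ q :+ r :* (z :+ q) :+ r :* con 1 :=
                            con 1 :+ q :+ r :* (con 1 :+ q) :+ z :* r :* con 1) refl q (q ^ 2) z ⟩
      1# + q + q ^ 2 * (1# + q) + z * q ^ 2 * 1#
        ≈⟨ +-cong A₂ (*-congˡ A-zero) ⟨
      A 2 + z * q ^ 2 * A 0 ∎
    kappa-identity (suc zero) = begin
      G 3 + r * A 1
        ≈⟨ +-cong (trans G-three (+-cong (trans G-two (+-congʳ (trans G-one A₁)))
                     (*-congˡ (+-congˡ (*-congˡ A₁))))) (*-congˡ A₁) ⟩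
      1# + q + r * (z + q) + q * r * (z + q + r * (1# + q)) + r * (1# + q)
        ≈⟨ solve 3 (λ q r z →
             con 1 :+ q :+ r :* (z :+ q) :+ q :* r :* (z :+ q :+ r :* (con 1 :+ q))
               :+ r :* (con 1 :+ q)
             := (con 1 :+ q :+ r :* (con 1 :+ q)) :+ q :* r :* (con 1 :+ q :+ r :* (con 1 :+ q))
               :+ z :* r :* (con 1 :+ q))
             refl q r z ⟩
      (1# + q + r * (1# + q)) + q * r * (1# + q + r * (1# + q)) + z * r * (1# + q)
        ≈⟨ +-cong (trans (A-suc 2) (+-cong A₂ (*-congˡ A₂))) (*-congˡ A₁) ⟨
      A 3 + z * r * A 1 ∎
      where r = q ^ 2
    kappa-identity (suc (suc K)) = begin
      G (3 ℕ.+ M) + q ^ 2 * b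
        ≈⟨ +-cong (G-suc K) (*-congˡ b-eq) ⟩
      G (2 ℕ.+ M) + q * (q * s) * (z * a + s * a + q * s * b) + q ^ 2 * (a + s * a)
        -- The summand `q ^ 2 * s * a` of `q ^ 2 * b` moves into the bracket, where it supplies the
        -- `a` needed to complete `d`.
        ≈⟨ solve 6 (λ g q s z a b →
             g :+ q :* (q :* s) :* (z :* a :+ s :* a :+ q :* s :* b) :+ q :* (q :* con 1) :* (a :+ s :* a)
             := (g :+ q :* (q :* con 1) :* a)
                :+ q :* (q :* s) :* (z :* a :+ ((a :+ s :* a) :+ q :* s :* b)))
             refl (G (2 ℕ.+ M)) q s z a b ⟩
      (G (2 ℕ.+ M) + q ^ 2 * a) + q * (q * s) * (z * a + ((a + s * a) + q * s * b))
        ≈⟨ +-cong (kappa-identity (suc K)) (*-congˡ (+-congˡ (sym d-eq))) ⟩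
      (d + z * q ^ 2 * a) + q * (q * s) * (z * a + d)
        ≈⟨ solve 5 (λ d q s z a →
             (d :+ z :* (q :* (q :* con 1)) :* a) :+ q :* (q :* s) :* (z :* a :+ d)
             := (d :+ q :* (q :* s) :* d) :+ z :* (q :* (q :* con 1)) :* (a :+ s :* a))
             refl d q s z a ⟩
      (d + q * (q * s) * d) + z * q ^ 2 * (a + s * a)
        ≈⟨ +-cong (A-suc (2 ℕ.+ M)) (*-congˡ b-eq) ⟨
      A (3 ℕ.+ M) + z * q ^ 2 * b ∎
      where
      M = suc K
      s = q ^ suc M
      a = A M
      b = A (1 ℕ.+ M)
      d = A (2 ℕ.+ M)
      b-eq : b ≈ a + s * a
      b-eq = A-suc M
      -- The three ranges of the largest part are those that `G-suc` distinguishes for the second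
      -- largest part, here without weights.
      d-eq : d ≈ (a + s * a) + q * s * b
      d-eq = trans (A-suc (suc M)) (+-congʳ b-eq)

  -- Assembling the product identity

  combine : ∀ {A A′ B b C G X Y P p z} → B * b ≈ 1# → A′ ≈ A →
            G + p * A′ ≈ A + z * p * A′ → (1- p + z * p + C) * (X * Y) ≈ P →
            (G + C * A) * B * (b * X * Y) ≈ A * P
  combine {A} {A′} {B} {b} {C} {G} {X} {Y} {P} {p} {z} Bb≈1 A′≈A kappa crank = begin
    (G + C * A) * B * (b * X * Y)
      ≈⟨ solve 5 (λ g B b X Y → g :* B :* (b :* X :* Y) := B :* b :* (g :* (X :* Y))) refl
           (G + C * A) B b X Y ⟩
    B * b * ((G + C * A) * (X * Y))
      ≈⟨ trans (*-congʳ Bb≈1) (*-identityˡ _) ⟩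
    (G + C * A) * (X * Y)
      ≈⟨ *-congʳ (+-congʳ G≈) ⟩
    ((1- p + z * p) * A + C * A) * (X * Y)
      ≈⟨ solve 4 (λ u A C v → (u :* A :+ C :* A) :* v := A :* ((u :+ C) :* v)) refl
           (1- p + z * p) A C (X * Y) ⟩
    A * ((1- p + z * p + C) * (X * Y))
      ≈⟨ *-congˡ crank ⟩
    A * P ∎
    where
    -- `A` and `A′` will be the same generating function with two bounds on the parts, equal after
    -- truncation. Adding `p * A` on both sides keeps the identity within the reach of a semiring
    -- solver.
    G≈ : G ≈ (1- p + z * p) * A
    G≈ = +-cancelʳ (p * A) G _ (begin
      G + p * A                          ≈⟨ +-congˡ (*-congˡ A′≈A) ⟨
      G + p * A′                         ≈⟨ kappa ⟩
      A + z * p * A′                     ≈⟨ +-cong (sym (*-identityˡ A)) (*-congˡ A′≈A) ⟩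
      1# * A + z * p * A                 ≈⟨ +-congʳ (*-congʳ (1-x+x≈1 p)) ⟨
      (1- p + p) * A + z * p * A
        ≈⟨ solve 4 (λ u p z A → (u :+ p) :* A :+ z :* p :* A := (u :+ z :* p) :* A :+ p :* A) refl
             (1- p) p z A ⟩
      (1- p + z * p) * A + p * A         ∎)

  partition-poch : ∀ {q p} (B : ℕ → Carrier) → B 0 ≈ 1# →
                   (∀ K → B (suc K) ≈ B K + q * p ^ K * B (suc K)) →
                   ∀ K → B K * poch q p K ≈ 1#
  partition-poch         B B₀ B-suc zero    = trans (*-identityʳ (B 0)) B₀
  partition-poch {q} {p} B B₀ B-suc (suc K) = begin
    B (suc K) * (poch q p K * (1- (q * p ^ K)))
      ≈⟨ solve 3 (λ b P u → b :* (P :* u) := b :* u :* P) refl _ _ _ ⟩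
    B (suc K) * (1- (q * p ^ K)) * poch q p K
      ≈⟨ *-congʳ (geometric-* (B-suc K)) ⟩
    B K * poch q p K
      ≈⟨ partition-poch B B₀ B-suc K ⟩
    1# ∎

  distinct-poch : ∀ {q} (A : ℕ → Carrier) → A 0 ≈ 1# →
                  (∀ K → A (suc K) ≈ A K + q ^ suc K * A K) →
                  ∀ K → A K ≈ poch (- q) q K
  distinct-poch     A A₀ A-suc zero    = A₀
  distinct-poch {q} A A₀ A-suc (suc K) = begin
    A (suc K)                         ≈⟨ A-suc K ⟩
    A K + q ^ suc K * A K
      ≈⟨ solve 2 (λ a x → a :+ x :* a := a :* (con 1 :+ x)) refl (A K) (q ^ suc K) ⟩
    A K * (1# + q ^ suc K)
      ≈⟨ *-cong (distinct-poch A A₀ A-suc K)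
           (+-congˡ (sym (trans (-‿cong (sym (-‿distribˡ-* q (q ^ K)))) (-‿involutive _)))) ⟩
    poch (- q) q K * (1- (- q * q ^ K)) ∎

  quotient-unique : ∀ {s d r n} → d * r ≈ 1# → s * d ≈ n → s ≈ n * r
  quotient-unique {s} {d} {r} {n} dr≈1 sd≈n = begin
    s              ≈⟨ *-identityʳ s ⟨
    s * 1#         ≈⟨ *-congˡ dr≈1 ⟨
    s * (d * r)    ≈⟨ *-assoc s d r ⟨
    s * d * r      ≈⟨ *-congʳ sd≈n ⟩
    n * r          ∎

open import Defs

-- Power series modulo q^(N+1)

-- A record wrapper around _≈_, from which Agda can infer both sides.
infix 4 _≋_
record _≋_ (a b : Laurent) : Set where
  constructor wrap
  field coeffs : a ≈ b
open _≋_

⊗-distribʳ : ∀ a b c → (a ⊕ b) ⊗ c ≋ (a ⊗ c) ⊕ (b ⊗ c)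
⊗-distribʳ []      b c = wrap λ _ → ≡.refl
⊗-distribʳ (t ∷ a) b c = wrap λ m →
  ≡.trans (coeff-⊕ (scale t c) _ m)
  (≡.trans (≡.cong (ℤ._+_ (coeff (scale t c) m))
            (≡.trans (coeffs (⊗-distribʳ a b c) m) (coeff-⊕ (a ⊗ c) _ m)))
  (≡.trans (≡.sym (ℤₚ.+-assoc (coeff (scale t c) m) _ _))
  (≡.trans (≡.cong (ℤ._+ _) (≡.sym (coeff-⊕ (scale t c) _ m)))
           (≡.sym (coeff-⊕ (scale t c ⊕ a ⊗ c) _ m)))))

scale-scale : ∀ t u a → scale t (scale u a) ≡
              scale (proj₁ t ℤ.+ proj₁ u , proj₂ t ℤ.* proj₂ u) a
scale-scale t u []      = ≡.refl
scale-scale t u (v ∷ a) = ≡.cong₂ _∷_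
  (≡.cong₂ _,_ (≡.sym (ℤₚ.+-assoc (proj₁ t) _ _)) (≡.sym (ℤₚ.*-assoc (proj₂ t) _ _)))
  (scale-scale t u a)

scale-⊕ : ∀ t a b → scale t (a ⊕ b) ≡ scale t a ⊕ scale t b
scale-⊕ t []      b = ≡.refl
scale-⊕ t (u ∷ a) b = ≡.cong (_ ∷_) (scale-⊕ t a b)

scale-⊗ : ∀ t a b → scale t a ⊗ b ≡ scale t (a ⊗ b)
scale-⊗ t []      b = ≡.refl
scale-⊗ t (u ∷ a) b = ≡.trans
  (≡.cong₂ _⊕_ (≡.sym (scale-scale t u b)) (scale-⊗ t a b))
  (≡.sym (scale-⊕ t (scale u b) (a ⊗ b)))

⊗-assoc : ∀ a b c → (a ⊗ b) ⊗ c ≋ a ⊗ (b ⊗ c)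
⊗-assoc []      b c = wrap λ _ → ≡.refl
⊗-assoc (t ∷ a) b c = wrap λ m → ≡.trans (coeffs (⊗-distribʳ (scale t b) (a ⊗ b) c) m)
  (⊕-cong (scale t b ⊗ c) (scale t (b ⊗ c)) ((a ⊗ b) ⊗ c) (a ⊗ (b ⊗ c))
    (λ k → ≡.cong (λ x → coeff x k) (scale-⊗ t b c)) (coeffs (⊗-assoc a b c)) m)

⊕-comm : ∀ a b → a ⊕ b ≈ b ⊕ a
⊕-comm a b m = ≡.trans (coeff-⊕ a b m)
  (≡.trans (ℤₚ.+-comm (coeff a m) _) (≡.sym (coeff-⊕ b a m)))

⊕-inverseʳ : ∀ a → a ⊕ neg a ≈ 𝟘
⊕-inverseʳ a m = ≡.trans (coeff-⊕ a (neg a) m)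
  (≡.trans (≡.cong (ℤ._+_ (coeff a m)) (coeff-neg a m)) (ℤₚ.+-inverseʳ (coeff a m)))

neg-cong : ∀ {a b} → a ≋ b → neg a ≋ neg b
neg-cong {a} {b} (wrap p) = wrap (scale-cong (0ℤ , -1ℤ) a b p)

laurentRing : CommutativeRing 0ℓ 0ℓ
laurentRing = record
  { Carrier = Laurent
  ; _≈_ = _≋_ ; _+_ = _⊕_ ; _*_ = _⊗_ ; -_ = neg ; 0# = 𝟘 ; 1# = 𝟙
  ; isCommutativeRing = record
    { isRing = record
      { +-isAbelianGroup = record
        { isGroup = record
          { isMonoid = record
            { isSemigroup = record
              { isMagma = record
                { isEquivalence = record
                  { refl  = wrap λ _ → ≡.refl
                  ; sym   = λ p → wrap λ m → ≡.sym (coeffs p m)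
                  ; trans = λ p r → wrap λ m → ≡.trans (coeffs p m) (coeffs r m)
                  }
                ; ∙-cong = λ {a} {a′} {b} {b′} p r →
                    wrap (⊕-cong a a′ b b′ (coeffs p) (coeffs r))
                }
              ; assoc = λ a b c → wrap λ m →
                  ≡.cong (λ x → coeff x m) (++-assoc a b c)
              }
            ; identity = (λ a → wrap λ _ → ≡.refl) ,
                         (λ a → wrap λ m → ≡.cong (λ x → coeff x m) (++-identityʳ a))
            }
          ; inverse = (λ a → wrap λ m → ≡.trans (⊕-comm (neg a) a m) (⊕-inverseʳ a m)) ,
                      (λ a → wrap (⊕-inverseʳ a))
          ; ⁻¹-cong = neg-cong
          }
        ; comm = λ a b → wrap (⊕-comm a b)
        }
      ; *-cong = λ {a} {a′} {b} {b′} p r → wrap λ m →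
          ≡.trans (⊗-congˡ a a′ b (coeffs p) m) (⊗-congʳ a′ b b′ (coeffs r) m)
      ; *-assoc = ⊗-assoc
      ; *-identity = (λ a → wrap (⊗-identityˡ a)) , (λ a → wrap (⊗-identityʳ a))
      ; distrib = (λ a b c → wrap λ m →
            ≡.trans (⊗-comm a (b ⊕ c) m)
            (≡.trans (coeffs (⊗-distribʳ b c a) m)
                     (⊕-cong (b ⊗ a) (a ⊗ b) (c ⊗ a) (a ⊗ c) (⊗-comm b a) (⊗-comm c a) m)))
          , (λ a b c → ⊗-distribʳ b c a)
      }
    ; *-comm = λ a b → wrap (⊗-comm a b)
    }
  }

private
  module L = CommutativeRing laurentRing

module _ where
  open L using () renaming (_≈_ to _≈ᴸ_)
  open import Relation.Binary.Reasoning.Setoid L.setoid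
  open import Algebra.Solver.Ring.NaturalCoefficients.Default L.commutativeSemiring
    using (solve; _:=_; _:+_; _:*_)

  infixr 7 _∙ₛ_
  _∙ₛ_ : Laurent → Series → Series
  (a ∙ₛ f) n = a ⊗ f n

  infixl 6 _+ₛ_
  _+ₛ_ : Series → Series → Series
  (f +ₛ g) n = f n ⊕ g n

  *ₛ-cong : ∀ n {f f′ g g′} → (∀ i → i ≤ n → f i ≋ f′ i) → (∀ i → i ≤ n → g i ≋ g′ i) →
            (f *ₛ g) n ≋ (f′ *ₛ g′) n
  *ₛ-cong zero    p r = L.*-cong (p 0 z≤n) (r 0 z≤n)
  *ₛ-cong (suc n) p r = L.+-cong
    (L.*-cong (p 0 z≤n) (r (suc n) ℕₚ.≤-refl))
    (*ₛ-cong n (λ i i≤n → p (suc i) (s≤s i≤n)) (λ i i≤n → r i (ℕₚ.m≤n⇒m≤1+n i≤n)))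

  *ₛ-distribʳ : ∀ n f g h → ((f +ₛ g) *ₛ h) n ≋ (f *ₛ h) n ⊕ (g *ₛ h) n
  *ₛ-distribʳ zero    f g h = L.distribʳ (h 0) (f 0) (g 0)
  *ₛ-distribʳ (suc n) f g h = begin
    (f 0 ⊕ g 0) ⊗ h (suc n) ⊕ ((f ∘ suc +ₛ g ∘ suc) *ₛ h) n
      ≈⟨ L.+-congˡ (*ₛ-distribʳ n (f ∘ suc) (g ∘ suc) h) ⟩
    (f 0 ⊕ g 0) ⊗ h (suc n) ⊕ (((f ∘ suc) *ₛ h) n ⊕ ((g ∘ suc) *ₛ h) n)
      ≈⟨ solve 5 (λ a b c x y → (a :+ b) :* c :+ (x :+ y) := (a :* c :+ x) :+ (b :* c :+ y))
           L.refl (f 0) (g 0) (h (suc n)) (((f ∘ suc) *ₛ h) n) (((g ∘ suc) *ₛ h) n) ⟩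
    (f *ₛ h) (suc n) ⊕ (g *ₛ h) (suc n) ∎

  ∙ₛ-*ₛ : ∀ n a f g → ((a ∙ₛ f) *ₛ g) n ≋ a ⊗ (f *ₛ g) n
  ∙ₛ-*ₛ zero    a f g = L.*-assoc a (f 0) (g 0)
  ∙ₛ-*ₛ (suc n) a f g = begin
    (a ⊗ f 0) ⊗ g (suc n) ⊕ ((a ∙ₛ (f ∘ suc)) *ₛ g) n
      ≈⟨ L.+-cong (L.*-assoc a _ _) (∙ₛ-*ₛ n a (f ∘ suc) g) ⟩
    a ⊗ (f 0 ⊗ g (suc n)) ⊕ a ⊗ ((f ∘ suc) *ₛ g) n
      ≈⟨ L.distribˡ a _ _ ⟨
    a ⊗ (f *ₛ g) (suc n) ∎

  -- The tail of `f *ₛ g` unfolds to `f 0 ∙ₛ (g ∘ suc) +ₛ (f ∘ suc) *ₛ g`, so distributivity and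
  -- scalar multiplication reduce the claim to the tail of `f`.
  *ₛ-assoc : ∀ n f g h → ((f *ₛ g) *ₛ h) n ≋ (f *ₛ (g *ₛ h)) n
  *ₛ-assoc zero    f g h = L.*-assoc (f 0) (g 0) (h 0)
  *ₛ-assoc (suc n) f g h = begin
    (f 0 ⊗ g 0) ⊗ h (suc n) ⊕ ((f 0 ∙ₛ (g ∘ suc) +ₛ (f ∘ suc) *ₛ g) *ₛ h) n
      ≈⟨ L.+-cong (L.*-assoc (f 0) (g 0) _)
           (L.trans (*ₛ-distribʳ n (f 0 ∙ₛ (g ∘ suc)) ((f ∘ suc) *ₛ g) h)
                    (L.+-cong (∙ₛ-*ₛ n (f 0) (g ∘ suc) h) (*ₛ-assoc n (f ∘ suc) g h))) ⟩
    f 0 ⊗ (g 0 ⊗ h (suc n)) ⊕ (f 0 ⊗ ((g ∘ suc) *ₛ h) n ⊕ ((f ∘ suc) *ₛ (g *ₛ h)) n)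
      ≈⟨ L.+-assoc (f 0 ⊗ (g 0 ⊗ h (suc n))) (f 0 ⊗ ((g ∘ suc) *ₛ h) n) (((f ∘ suc) *ₛ (g *ₛ h)) n) ⟨
    f 0 ⊗ (g 0 ⊗ h (suc n)) ⊕ f 0 ⊗ ((g ∘ suc) *ₛ h) n ⊕ ((f ∘ suc) *ₛ (g *ₛ h)) n
      ≈⟨ L.+-congʳ (L.distribˡ (f 0) _ _) ⟨
    (f *ₛ (g *ₛ h)) (suc n) ∎

  -- The Cauchy product is defined by peeling its left factor; peeling the right one instead is what
  -- commutativity requires.
  *ₛ-sucʳ : ∀ n f g → (f *ₛ g) (suc n) ≋ f (suc n) ⊗ g 0 ⊕ (f *ₛ (g ∘ suc)) n
  *ₛ-sucʳ zero    f g = L.+-comm (f 0 ⊗ g 1) (f 1 ⊗ g 0)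
  *ₛ-sucʳ (suc n) f g = begin
    f 0 ⊗ g (suc (suc n)) ⊕ ((f ∘ suc) *ₛ g) (suc n)
      ≈⟨ L.+-congˡ {f 0 ⊗ g (suc (suc n))} (*ₛ-sucʳ n (f ∘ suc) g) ⟩
    f 0 ⊗ g (suc (suc n)) ⊕ (f (suc (suc n)) ⊗ g 0 ⊕ ((f ∘ suc) *ₛ (g ∘ suc)) n)
      ≈⟨ solve 3 (λ a b c → a :+ (b :+ c) := b :+ (a :+ c)) L.refl
           (f 0 ⊗ g (suc (suc n))) (f (suc (suc n)) ⊗ g 0) (((f ∘ suc) *ₛ (g ∘ suc)) n) ⟩
    f (suc (suc n)) ⊗ g 0 ⊕ (f *ₛ (g ∘ suc)) (suc n) ∎

  *ₛ-comm : ∀ n f g → (f *ₛ g) n ≋ (g *ₛ f) n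
  *ₛ-comm zero    f g = L.*-comm (f 0) (g 0)
  *ₛ-comm (suc n) f g = begin
    f 0 ⊗ g (suc n) ⊕ ((f ∘ suc) *ₛ g) n
      ≈⟨ L.+-cong (L.*-comm (f 0) (g (suc n))) (*ₛ-comm n (f ∘ suc) g) ⟩
    g (suc n) ⊗ f 0 ⊕ (g *ₛ (f ∘ suc)) n
      ≈⟨ *ₛ-sucʳ n g f ⟨
    (g *ₛ f) (suc n) ∎

  *ₛ-zeroˡ : ∀ n f → ((λ _ → 𝟘) *ₛ f) n ≋ 𝟘
  *ₛ-zeroˡ zero    f = L.refl
  *ₛ-zeroˡ (suc n) f = *ₛ-zeroˡ n f

  *ₛ-identityˡ : ∀ n f → (one *ₛ f) n ≋ f n
  *ₛ-identityˡ zero    f = L.*-identityˡ (f 0)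
  *ₛ-identityˡ (suc n) f = L.trans (L.+-cong (L.*-identityˡ (f (suc n))) (*ₛ-zeroˡ n f))
                                   (L.+-identityʳ (f (suc n)))

infix 4 _≈[_]_
record _≈[_]_ (f : Series) (N : ℕ) (g : Series) : Set where
  constructor upTo
  field at : ∀ n → n ≤ N → f n ≋ g n
open _≈[_]_

-- Equality up to the coefficient of q^N makes q nilpotent, so the infinite
-- products become finite ones.
seriesRing : ℕ → CommutativeRing 0ℓ 0ℓ
seriesRing N = record
  { Carrier = Series
  ; _≈_ = _≈[ N ]_ ; _+_ = _+ₛ_ ; _*_ = _*ₛ_ ; -_ = minus ; 0# = λ _ → 𝟘 ; 1# = one
  ; isCommutativeRing = record
    { isRing = record
      { +-isAbelianGroup = record
        { isGroup = record
          { isMonoid = record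
            { isSemigroup = record
              { isMagma = record
                { isEquivalence = record
                  { refl  = upTo λ _ _ → L.refl
                  ; sym   = λ p → upTo λ n n≤N → L.sym (at p n n≤N)
                  ; trans = λ p r → upTo λ n n≤N → L.trans (at p n n≤N) (at r n n≤N)
                  }
                ; ∙-cong = λ p r → upTo λ n n≤N → L.+-cong (at p n n≤N) (at r n n≤N)
                }
              ; assoc = λ f g h → upTo λ n _ → L.+-assoc (f n) (g n) (h n)
              }
            ; identity = (λ f → upTo λ n _ → L.refl) , (λ f → upTo λ n _ → L.+-identityʳ (f n))
            }
          ; inverse = (λ f → upTo λ n _ → L.-‿inverseˡ (f n)) ,
                      (λ f → upTo λ n _ → L.-‿inverseʳ (f n))
          ; ⁻¹-cong = λ p → upTo λ n n≤N → neg-cong (at p n n≤N)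
          }
        ; comm = λ f g → upTo λ n _ → L.+-comm (f n) (g n)
        }
      ; *-cong = λ p r → upTo λ n n≤N → *ₛ-cong n
          (λ i i≤n → at p i (ℕₚ.≤-trans i≤n n≤N)) (λ i i≤n → at r i (ℕₚ.≤-trans i≤n n≤N))
      ; *-assoc = λ f g h → upTo λ n _ → *ₛ-assoc n f g h
      ; *-identity = (λ f → upTo λ n _ → *ₛ-identityˡ n f) ,
                     (λ f → upTo λ n _ → L.trans (*ₛ-comm n f one) (*ₛ-identityˡ n f))
      ; distrib = (λ f g h → upTo λ n _ → L.trans (*ₛ-comm n f (g +ₛ h))
                    (L.trans (*ₛ-distribʳ n g h f) (L.+-cong (*ₛ-comm n g f) (*ₛ-comm n h f))))
                , (λ f g h → upTo λ n _ → *ₛ-distribʳ n g h f)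
      }
    ; *-comm = λ f g → upTo λ n _ → *ₛ-comm n f g
    }
  }

open import Axiom.UniquenessOfIdentityProofs using (module Decidable⇒UIP)
open import Data.Bool using (true; false; if_then_else_)
open import Data.Bool.Properties using (∨-zeroʳ)
open import Data.Empty using (⊥; ⊥-elim)
open import Data.Fin using (Fin; zero; suc)
open import Data.List.Membership.DecPropositional using () renaming (_∈?_ to ∈?-from)
open import Data.List.Membership.Propositional using (_∈_)
open import Data.List.Membership.Propositional.Properties
  using (∈-++⁺ˡ; ∈-++⁺ʳ; ∈-++⁻; ∈-map⁺; ∈-map⁻; ∈-filter⁺; ∈-filter⁻; ∈-lookup;
         ∈-cartesianProduct⁺; ∈-cartesianProduct⁻)
open import Data.List.Properties
  using (∷-injectiveʳ; map-injective; map-++; map-∘; map-id; map-cong-local; length-map;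
         length-filter; filter-accept; filter-reject; filter-none; ≡-dec)
open import Data.List.Relation.Unary.All as All using (All; []; _∷_)
import Data.List.Relation.Unary.All.Properties as Allₚ
open import Data.List.Relation.Unary.AllPairs using ([]; _∷_)
open import Data.List.Relation.Unary.Any using (here; there; index)
open import Data.List.Relation.Unary.Any.Properties using (lookup-index)
open import Data.List.Relation.Unary.Linked as Linked using (Linked; []; [-]; _∷_)
open import Data.List.Relation.Unary.Linked.Properties using (Linked⇒All)
import Data.List.Relation.Unary.Linked.Properties as Linkedₚ
open import Data.List.Relation.Unary.Unique.Propositional using (Unique)
import Data.List.Relation.Unary.Unique.Propositional.Properties as Uniqueₚ
open import Data.Nat using (_+_; _*_)
open import Data.Nat.Divisibility using (_∣_; _∤_; divides)
open import Data.Nat.DivMod using (m*n/n≡m)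
open import Data.Nat.Induction using (<-rec)
open import Data.Nat.ListAction using (sum)
import Data.Product.Properties as Productₚ
open import Data.Sum using (_⊎_; inj₁; inj₂; [_,_]′)
open import Function.Bundles using (_↔_; mk↔ₛ′)
open import Relation.Nullary using (¬_; Dec; does; contradiction)
open import Relation.Nullary.Decidable using (dec-true; dec-false; recompute)
open import Relation.Binary.PropositionalEquality using (refl; sym; trans; cong; cong₂; subst)

-- Graded enumerations

Graded : Set → Set
Graded A = ℕ → List A

private
  variable
    A B : Set
    X Y : Graded A
    R S : ℕ → A → Set

-- Without repetitions the length of `X n` is the number of objects of size `n`, so identities
-- between lists become identities between counts.
record Enumerates (X : Graded A) (R : ℕ → A → Set) : Set where
  field
    sound    : ∀ {n a} → a ∈ X n → R n a
    complete : ∀ {n a} → R n a → a ∈ X n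
    unique   : ∀ n → Unique (X n)
open Enumerates

enum-⇔ : (∀ {n a} → R n a → S n a) → (∀ {n a} → S n a → R n a) → Enumerates X R → Enumerates X S
enum-⇔ to from e = record
  { sound = to ∘ sound e ; complete = complete e ∘ from ; unique = unique e }

∅ : Graded A
∅ _ = []

enum-∅ : (∀ {n a} → ¬ R n a) → Enumerates ∅ R
enum-∅ none = record { sound = λ () ; complete = ⊥-elim ∘ none ; unique = λ _ → [] }

unit : A → Graded A
unit b zero    = [ b ]
unit b (suc _) = []

enum-unit : ∀ {b : A} → Enumerates (unit b) (λ n a → n ≡ 0 × a ≡ b)
enum-unit .sound {zero} (here a≡b) = refl , a≡b
enum-unit .complete (refl , refl) = here refl
enum-unit .unique zero    = [] ∷ []
enum-unit .unique (suc _) = []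

infixr 5 _⊞_
_⊞_ : Graded A → Graded A → Graded A
(X ⊞ Y) n = X n ++ Y n

enum-⊞ : (∀ {n a} → R n a → ¬ S n a) → Enumerates X R → Enumerates Y S →
         Enumerates (X ⊞ Y) (λ n a → R n a ⊎ S n a)
enum-⊞ {X = X} disjoint eX eY = record
  { sound    = λ {n} a∈ → [ inj₁ ∘ sound eX , inj₂ ∘ sound eY ]′ (∈-++⁻ (X n) a∈)
  ; complete = λ {n} → [ ∈-++⁺ˡ ∘ complete eX , ∈-++⁺ʳ (X n) ∘ complete eY ]′
  ; unique   = λ n → Uniqueₚ.++⁺ (unique eX n) (unique eY n)
                       (λ (a∈X , a∈Y) → disjoint (sound eX a∈X) (sound eY a∈Y))
  }

enum-map : ∀ {f : A → B} → (∀ {a b} → f a ≡ f b → a ≡ b) → Enumerates X R →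
           Enumerates (map f ∘ X) (λ n b → ∃[ a ] (b ≡ f a × R n a))
enum-map {f = f} injective e = record
  { sound    = λ b∈ → let (a , a∈ , b≡) = ∈-map⁻ f b∈ in a , b≡ , sound e a∈
  ; complete = λ { (a , refl , r) → ∈-map⁺ f (complete e r) }
  ; unique   = λ n → Uniqueₚ.map⁺ injective (unique e n)
  }

shift : ℕ → Graded A → Graded A
shift zero    X n       = X n
shift (suc s) X zero    = []
shift (suc s) X (suc n) = shift s X n

∈-shift⁺ : ∀ s {X : Graded A} {n a} → a ∈ X n → a ∈ shift s X (s + n)
∈-shift⁺ zero    a∈ = a∈
∈-shift⁺ (suc s) a∈ = ∈-shift⁺ s a∈

∈-shift⁻ : ∀ s {X : Graded A} n {a} → a ∈ shift s X n → ∃[ m ] (n ≡ s + m × a ∈ X m)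
∈-shift⁻ zero    n       a∈ = n , refl , a∈
∈-shift⁻ (suc s) (suc n) a∈ = let (m , n≡ , a∈′) = ∈-shift⁻ s n a∈ in m , cong suc n≡ , a∈′

unique-shift : ∀ s {X : Graded A} n → (∀ m → n ≡ s + m → Unique (X m)) → Unique (shift s X n)
unique-shift zero    n       u = u n refl
unique-shift (suc s) zero    u = []
unique-shift (suc s) (suc n) u = unique-shift s n (λ m n≡ → u m (cong suc n≡))

enum-shift : ∀ s → Enumerates X R → Enumerates (shift s X) (λ n a → ∃[ m ] (n ≡ s + m × R m a))
enum-shift s e = record
  { sound    = λ {n} a∈ → let (m , n≡ , a∈′) = ∈-shift⁻ s n a∈ in m , n≡ , sound e a∈′
  ; complete = λ { (m , refl , r) → ∈-shift⁺ s (complete e r) }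
  ; unique   = λ n → unique-shift s n (λ m _ → unique e m)
  }

map-shift : ∀ (f : A → B) s X n → map f (shift s X n) ≡ shift s (map f ∘ X) n
map-shift f zero    X n       = refl
map-shift f (suc s) X zero    = refl
map-shift f (suc s) X (suc n) = map-shift f s X n

-- The solution G of G = X ⊞ shift (suc s) (map c ∘ G).  The function delay is
-- shift applied to it, inlined for the termination checker.
geometric : ℕ → (A → A) → Graded A → Graded A
delay     : ℕ → (A → A) → Graded A → ℕ → Graded A
geometric s c X zero    = X 0
geometric s c X (suc n) = X (suc n) ++ map c (delay s c X s n)
delay s c X zero    n       = geometric s c X n
delay s c X (suc k) zero    = []
delay s c X (suc k) (suc n) = delay s c X k n

delay≡shift : ∀ s c (X : Graded A) k n → delay s c X k n ≡ shift k (geometric s c X) n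
delay≡shift s c X zero    n       = refl
delay≡shift s c X (suc k) zero    = refl
delay≡shift s c X (suc k) (suc n) = delay≡shift s c X k n

geometric-unfold : ∀ s c (X : Graded A) n →
  geometric s c X n ≡ (X ⊞ shift (suc s) (map c ∘ geometric s c X)) n
geometric-unfold s c X zero    = sym (++-identityʳ (X 0))
geometric-unfold s c X (suc n) = cong (X (suc n) ++_)
  (trans (cong (map c) (delay≡shift s c X s n)) (map-shift c s (geometric s c X) n))

module _ {s : ℕ} {c : A → A} (c-injective : ∀ {a b} → c a ≡ c b → a ≡ b)
  (split   : ∀ {n a} → S n a → R n a ⊎ ∃[ m ] ∃[ b ] (n ≡ suc s + m × a ≡ c b × S m b))
  (weaken  : ∀ {n a} → R n a → S n a)
  (extend  : ∀ {m b} → S m b → S (suc s + m) (c b))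
  (new     : ∀ {n b} → ¬ R n (c b))
  (e : Enumerates X R) where

  private
    G : Graded A
    G = geometric s c X

    EnumeratesAt : ℕ → Set
    EnumeratesAt n = (∀ {a} → a ∈ G n → S n a) × (∀ {a} → S n a → a ∈ G n) × Unique (G n)

    step : ∀ n → (∀ {m} → m < n → EnumeratesAt m) → EnumeratesAt n
    step n ih = snd , cmp , uni
      where
      unfold : G n ≡ (X ⊞ shift (suc s) (map c ∘ G)) n
      unfold = geometric-unfold s c X n

      smaller : ∀ {m} → n ≡ suc s + m → EnumeratesAt m
      smaller {m} n≡ = ih (subst (m <_) (sym n≡) (s≤s (ℕₚ.m≤n+m m s)))

      shifted : ∀ {a} → a ∈ shift (suc s) (map c ∘ G) n →
                ∃[ m ] ∃[ b ] (n ≡ suc s + m × a ≡ c b × S m b)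
      shifted a∈ with m , n≡ , a∈′ ← ∈-shift⁻ (suc s) n a∈ with b , b∈ , a≡ ← ∈-map⁻ c a∈′ =
        m , b , n≡ , a≡ , proj₁ (smaller n≡) b∈

      snd : ∀ {a} → a ∈ G n → S n a
      snd {a} a∈ with ∈-++⁻ (X n) (subst (a ∈_) unfold a∈)
      ... | inj₁ a∈X = weaken (sound e a∈X)
      ... | inj₂ a∈s with m , b , refl , refl , r ← shifted a∈s = extend r

      cmp : ∀ {a} → S n a → a ∈ G n
      cmp {a} r = subst (a ∈_) (sym unfold)
        ([ ∈-++⁺ˡ ∘ complete e
         , (λ { (m , b , refl , refl , r′) →
                ∈-++⁺ʳ (X n) (∈-shift⁺ (suc s) (∈-map⁺ c (proj₁ (proj₂ (smaller refl)) r′))) })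
         ]′ (split r))

      uni : Unique (G n)
      uni = subst Unique (sym unfold) (Uniqueₚ.++⁺ (unique e n)
        (unique-shift (suc s) n (λ m n≡ → Uniqueₚ.map⁺ c-injective (proj₂ (proj₂ (smaller n≡)))))
        (λ (a∈X , a∈s) → disjoint a∈X (shifted a∈s)))
        where
        disjoint : ∀ {a} → a ∈ X n → ∃[ m ] ∃[ b ] (n ≡ suc s + m × a ≡ c b × S m b) → ⊥
        disjoint a∈X (m , b , _ , refl , _) = new (sound e a∈X)

  -- Each use of `c` raises the size by `suc s`, which is positive; strong induction on the size
  -- therefore applies. By `new` nothing in `X` has the form `c b`, which rules out repetitions.
  enum-geometric : Enumerates (geometric s c X) S
  enum-geometric = record
    { sound    = λ {n} → proj₁ (holds n)
    ; complete = λ {n} → proj₁ (proj₂ (holds n))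
    ; unique   = λ n → proj₂ (proj₂ (holds n))
    }
    where
    holds : ∀ n → EnumeratesAt n
    holds = <-rec EnumeratesAt step

infixr 6 _⊠_
_⊠_ : Graded A → Graded B → Graded (A × B)
(X ⊠ Y) zero    = cartesianProduct (X 0) (Y 0)
(X ⊠ Y) (suc n) = cartesianProduct (X 0) (Y (suc n)) ++ ((X ∘ suc) ⊠ Y) n

-- A pair must not occur for two splittings `i + j` of the same size; this holds because `a`
-- determines `i`. The auxiliary claims range over all `X` and `R`, since the recursion passes to
-- `X ∘ suc`.
enum-⊠ : ∀ {A B : Set} {X : Graded A} {Y : Graded B} {R : ℕ → A → Set} {S : ℕ → B → Set} →
         (∀ {i j a} → R i a → R j a → i ≡ j) → Enumerates X R → Enumerates Y S →
         Enumerates (X ⊠ Y) (λ n (a , b) → ∃[ i ] ∃[ j ] (i + j ≡ n × R i a × S j b))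
enum-⊠ {A} {B} {_} {Y} {_} {S} functional eX eY = record
  { sound    = λ {n} → snd n eX
  ; complete = λ { (i , j , refl , r , t) → cmp i j eX r t }
  ; unique   = λ n → uni n eX functional
  }
  where
  enum-suc : ∀ {X : Graded A} {R : ℕ → A → Set} → Enumerates X R → Enumerates (X ∘ suc) (R ∘ suc)
  enum-suc e = record
    { sound = sound e ; complete = complete e ; unique = λ n → unique e (suc n) }

  snd : ∀ {X} {R : ℕ → A → Set} n → Enumerates X R → ∀ {ab} → ab ∈ (X ⊠ Y) n →
        ∃[ i ] ∃[ j ] (i + j ≡ n × R i (proj₁ ab) × S j (proj₂ ab))
  snd {X} zero    e ab∈ =
    let (a∈ , b∈) = ∈-cartesianProduct⁻ (X 0) (Y 0) ab∈
    in 0 , 0 , refl , sound e a∈ , sound eY b∈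
  snd {X} (suc n) e ab∈ with ∈-++⁻ (cartesianProduct (X 0) (Y (suc n))) ab∈
  ... | inj₁ ab∈₀ =
    let (a∈ , b∈) = ∈-cartesianProduct⁻ (X 0) (Y (suc n)) ab∈₀
    in 0 , suc n , refl , sound e a∈ , sound eY b∈
  ... | inj₂ ab∈₁ =
    let (i , j , i+j≡n , r , t) = snd n (enum-suc e) ab∈₁
    in suc i , j , cong suc i+j≡n , r , t

  cmp : ∀ {X} {R : ℕ → A → Set} i j → Enumerates X R → ∀ {a b} → R i a → S j b → (a , b) ∈ (X ⊠ Y) (i + j)
  cmp zero    zero    e r t = ∈-cartesianProduct⁺ (complete e r) (complete eY t)
  cmp zero    (suc j) e r t = ∈-++⁺ˡ (∈-cartesianProduct⁺ (complete e r) (complete eY t))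
  cmp {X} (suc i) j e r t =
    ∈-++⁺ʳ (cartesianProduct (X 0) (Y (suc i + j))) (cmp i j (enum-suc e) r t)

  uni : ∀ {X} {R : ℕ → A → Set} n → Enumerates X R → (∀ {i j a} → R i a → R j a → i ≡ j) → Unique ((X ⊠ Y) n)
  uni zero    e fun = Uniqueₚ.cartesianProduct⁺ (unique e 0) (unique eY 0)
  uni {X} (suc n) e fun = Uniqueₚ.++⁺
    (Uniqueₚ.cartesianProduct⁺ (unique e 0) (unique eY (suc n)))
    (uni n (enum-suc e) (λ r t → ℕₚ.suc-injective (fun r t)))
    λ (ab∈₀ , ab∈₁) →
      let (_ , _ , _ , r , _) = snd n (enum-suc e) ab∈₁
          (a∈ , _) = ∈-cartesianProduct⁻ (X 0) (Y (suc n)) ab∈₀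
      in ℕₚ.0≢1+n (fun (sound e a∈) r)

-- Partitions

linked-∷ : ∀ {k τ} → All (_≤ k) τ → Linked _≥_ τ → Linked _≥_ (k ∷ τ)
linked-∷ []        []        = [-]
linked-∷ (p ∷ _)   l         = p ∷ l

linked-bound : ∀ {k τ} → Linked _≥_ (k ∷ τ) → All (_≤ k) τ
linked-bound l = All.tail (Linked⇒All (λ i≥j j≥k → ℕₚ.≤-trans j≥k i≥j) ℕₚ.≤-refl l)

≤-suc-split : ∀ {K k} → k ≤ suc K → k ≤ K ⊎ k ≡ suc K
≤-suc-split k≤ with ℕₚ.m≤n⇒m<n∨m≡n k≤
... | inj₁ (s≤s k≤K) = inj₁ k≤K
... | inj₂ k≡        = inj₂ k≡

All≤-suc : ∀ {K τ} → All (_≤ K) τ → All (_≤ suc K) τ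
All≤-suc = All.map ℕₚ.m≤n⇒m≤1+n

zeros : List ℕ → ℕ
zeros τ = length (filter (_≟ 0) τ)

-- A partition is given by the indices of its parts, the part of index k being
-- f k; the parts of index 0 are counted separately.
module Parts (f d : ℕ → ℕ) (f-suc : ∀ k → f (suc k) ≡ suc (d k)) where

  size : List ℕ → ℕ
  size τ = sum (map f τ)

  -- The number `j` of parts of index 0 is fixed throughout because, for even parts, it is the
  -- number of ones that decides which other parts affect the crank.
  parts : ℕ → ℕ → Graded (List ℕ)
  parts j zero    = shift (j * f 0) (unit (replicate j 0))
  parts j (suc K) = geometric (d K) (suc K ∷_) (parts j K)

  record HasParts (j K n : ℕ) (τ : List ℕ) : Set where
    constructor hasParts
    field
      nonincreasing : Linked _≥_ τ
      bounded       : All (_≤ K) τ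
      zeros≡        : zeros τ ≡ j
      size≡         : size τ ≡ n
  open HasParts

  Extends : ℕ → ℕ → ℕ → List ℕ → Set
  Extends j K n τ = ∃[ m ] ∃[ σ ] (n ≡ suc (d K) + m × τ ≡ suc K ∷ σ × HasParts j (suc K) m σ)

  hasParts-split : ∀ {j K n τ} → HasParts j (suc K) n τ → HasParts j K n τ ⊎ Extends j K n τ
  hasParts-split {τ = []} (hasParts l b z s) = inj₁ (hasParts l [] z s)
  hasParts-split {K = K} {τ = k ∷ τ} (hasParts l (k≤ ∷ b) z s) with ≤-suc-split k≤
  ... | inj₁ k≤K  = inj₁ (hasParts l
          (k≤K ∷ All.map (λ i≤k → ℕₚ.≤-trans i≤k k≤K) (linked-bound l)) z s)
  ... | inj₂ refl = inj₂ (size τ , τ , trans (sym s) (cong (_+ size τ) (f-suc K)) , refl ,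
                          hasParts (Linked.tail l) b z refl)

  hasParts-weaken : ∀ {j K n τ} → HasParts j K n τ → HasParts j (suc K) n τ
  hasParts-weaken (hasParts l b z s) = hasParts l (All≤-suc b) z s

  hasParts-∷ : ∀ {j K m σ} → HasParts j (suc K) m σ →
               HasParts j (suc K) (suc (d K) + m) (suc K ∷ σ)
  hasParts-∷ {K = K} (hasParts l b z s) =
    hasParts (linked-∷ b l) (ℕₚ.≤-refl ∷ b) z (cong₂ _+_ (f-suc K) s)

  hasParts-new : ∀ {j K n σ} → ¬ HasParts j K n (suc K ∷ σ)
  hasParts-new h = ℕₚ.1+n≰n (All.head (bounded h))

  size-replicate : ∀ j → size (replicate j 0) ≡ j * f 0
  size-replicate zero    = refl
  size-replicate (suc j) = cong (_+_ (f 0)) (size-replicate j)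

  hasParts-replicate : ∀ j → HasParts j 0 (j * f 0) (replicate j 0)
  hasParts-replicate zero    = hasParts [] [] refl refl
  hasParts-replicate (suc j) with hasParts-replicate j
  ... | hasParts l b z s = hasParts (linked-∷ b l) (z≤n ∷ b) (cong suc z) (cong (_+_ (f 0)) s)

  zeros-replicate : ∀ {τ} → All (_≤ 0) τ → τ ≡ replicate (zeros τ) 0
  zeros-replicate []        = refl
  zeros-replicate (z≤n ∷ b) = cong (0 ∷_) (zeros-replicate b)

  enum-parts : ∀ j K → Enumerates (parts j K) (HasParts j K)
  enum-parts j zero    = enum-⇔
    (λ { (_ , refl , refl , refl) →
         subst (λ n → HasParts j 0 n (replicate j 0)) (sym (ℕₚ.+-identityʳ _)) (hasParts-replicate j) })
    (λ { {n} {τ} (hasParts l b refl s) →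
         0 , trans (sym s) (trans (cong size (zeros-replicate b))
               (trans (size-replicate (zeros τ)) (sym (ℕₚ.+-identityʳ _)))) ,
         refl , zeros-replicate b })
    (enum-shift (j * f 0) enum-unit)
  enum-parts j (suc K) = enum-geometric ∷-injectiveʳ hasParts-split hasParts-weaken
    hasParts-∷ hasParts-new (enum-parts j K)

  -- The crank is the largest part if there are no ones and depends on their number otherwise;
  -- accordingly `noOnes` is graded by the largest part and `withOnes` by the number of ones.
  noOnes : ℕ → Graded (List ℕ)
  noOnes zero    = ∅
  noOnes (suc K) = noOnes K ⊞ shift (suc (d K)) (map (suc K ∷_) ∘ parts 0 (suc K))

  withOnes : ℕ → ℕ → Graded (List ℕ)
  withOnes H zero    = ∅
  withOnes H (suc j) = withOnes H j ⊞ parts (suc j) H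

  enum-noOnes : ∀ K → Enumerates (noOnes K) (λ n τ → τ ≢ [] × HasParts 0 K n τ)
  enum-noOnes zero    = enum-∅ λ (τ≢[] , hasParts l b z s) →
    τ≢[] (trans (zeros-replicate b) (cong (λ j → replicate j 0) z))
  enum-noOnes (suc K) = enum-⇔
    (λ { (inj₁ (τ≢[] , h)) → τ≢[] , hasParts-weaken h
       ; (inj₂ (_ , refl , _ , refl , h)) → (λ ()) , hasParts-∷ h })
    (λ (τ≢[] , h) → [ (λ h′ → inj₁ (τ≢[] , h′))
                    , (λ (m , σ , n≡ , τ≡ , h′) → inj₂ (m , n≡ , σ , τ≡ , h′)) ]′ (hasParts-split h))
    (enum-⊞ (λ { (_ , h) (_ , _ , _ , refl , _) → hasParts-new h })
      (enum-noOnes K)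
      (enum-shift (suc (d K)) (enum-map ∷-injectiveʳ (enum-parts 0 (suc K)))))

  enum-withOnes : ∀ H J → Enumerates (withOnes H J)
                            (λ n τ → ∃[ j ] (j < J × HasParts (suc j) H n τ))
  enum-withOnes H zero    = enum-∅ λ ()
  enum-withOnes H (suc J) = enum-⇔
    (λ { (inj₁ (j , j<J , h)) → j , ℕₚ.m≤n⇒m≤1+n j<J , h
       ; (inj₂ h)             → J , ℕₚ.≤-refl , h })
    (λ { (j , s≤s j≤J , h) → [ (λ j<J → inj₁ (j , j<J , h)) , (λ { refl → inj₂ h }) ]′
                              (ℕₚ.m≤n⇒m<n∨m≡n j≤J) })
    (enum-⊞ (λ (j , j<J , h) h′ → ℕₚ.<-irrefl (ℕₚ.suc-injective (trans (sym (zeros≡ h)) (zeros≡ h′))) j<J)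
      (enum-withOnes H J) (enum-parts (suc J) H))

  nonempty : ℕ → Graded (List ℕ)
  nonempty H = noOnes H ⊞ withOnes H H

  Nonempty : ℕ → ℕ → List ℕ → Set
  Nonempty H n τ = τ ≢ [] × ∃[ j ] (j ≤ H × HasParts j H n τ)

  enum-nonempty : ∀ H → Enumerates (nonempty H) (Nonempty H)
  enum-nonempty H = enum-⇔
    (λ { (inj₁ (τ≢[] , h))    → τ≢[] , 0 , z≤n , h
       ; (inj₂ (j , j<H , h)) → (λ { refl → ℕₚ.0≢1+n (zeros≡ h) }) , suc j , j<H , h })
    (λ { (τ≢[] , zero , _ , h)    → inj₁ (τ≢[] , h)
       ; (τ≢[] , suc j , j<H , h) → inj₂ (j , j<H , h) })
    (enum-⊞ (λ (_ , h) (j , _ , h′) → ℕₚ.0≢1+n (trans (sym (zeros≡ h)) (zeros≡ h′)))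
      (enum-noOnes H) (enum-withOnes H H))

-- Partitions into distinct parts

distinct : ℕ → Graded (List ℕ)
distinct zero    = unit []
distinct (suc K) = distinct K ⊞ shift (suc K) (map (suc K ∷_) ∘ distinct K)

HasDistinct : ℕ → ℕ → List ℕ → Set
HasDistinct K n τ = PD τ × All (_≤ K) τ × sum τ ≡ n

enum-distinct : ∀ K → Enumerates (distinct K) (HasDistinct K)
enum-distinct zero    = enum-⇔
  (λ { (refl , refl) → (record { parts-positive = [] ; nonincreasing = [] } , []) , [] , refl })
  (λ { {_} {[]}     (_ , _ , s) → sym s , refl
     ; {_} {_ ∷ _} ((p , _) , k≤0 ∷ _ , _) →
         contradiction (All.head (IsPartition.parts-positive p)) (ℕₚ.≤⇒≯ k≤0) })
  enum-unit
enum-distinct (suc K) = enum-⇔ to from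
  (enum-⊞ (λ { (_ , b , _) (_ , _ , _ , refl , _) → ℕₚ.1+n≰n (All.head b) })
    (enum-distinct K) (enum-shift (suc K) (enum-map ∷-injectiveʳ (enum-distinct K))))
  where
  open IsPartition
  Extends : ℕ → List ℕ → Set
  Extends n τ = ∃[ m ] (n ≡ suc K + m × ∃[ σ ] (τ ≡ suc K ∷ σ × HasDistinct K m σ))

  to : ∀ {n τ} → HasDistinct K n τ ⊎ Extends n τ → HasDistinct (suc K) n τ
  to (inj₁ (pd , b , s)) = pd , All≤-suc b , s
  to (inj₂ (_ , refl , σ , refl , (p , u) , b , refl)) =
    (record { parts-positive = s≤s z≤n ∷ parts-positive p
            ; nonincreasing  = linked-∷ (All≤-suc b) (nonincreasing p) }
    , All.map (λ i≤K 1+K≡i → ℕₚ.<-irrefl (sym 1+K≡i) (s≤s i≤K)) b ∷ u)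
    , ℕₚ.≤-refl ∷ All≤-suc b , refl

  from : ∀ {n τ} → HasDistinct (suc K) n τ → HasDistinct K n τ ⊎ Extends n τ
  from {τ = []}    (pd , _ , s) = inj₁ (pd , [] , s)
  from {τ = k ∷ τ} ((p , k∉ ∷ u) , k≤ ∷ b , s) with ≤-suc-split k≤
  ... | inj₁ k≤K  = inj₁ ((p , k∉ ∷ u) ,
          (k≤K ∷ All.map (λ i≤k → ℕₚ.≤-trans i≤k k≤K) (linked-bound (nonincreasing p))) , s)
  ... | inj₂ refl = inj₂ (sum τ , sym s , τ , refl ,
          (record { parts-positive = All.tail (parts-positive p)
                  ; nonincreasing  = Linked.tail (nonincreasing p) } , u) ,
          All.zipWith (λ (i≤ , ≢i) → [ (λ i≤K → i≤K) , (λ i≡ → contradiction (sym i≡) ≢i) ]′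
                                       (≤-suc-split i≤)) (b , k∉) , refl)

-- Partitions into even and into odd parts

evenPart oddPart : ℕ → ℕ
evenPart k = suc k * 2
oddPart  k = pred (k * 2)

-- The part of index k of π₂ is 2 (k + 1), so index 0 stands for a one of π₂ / 2;
-- the part of index k + 1 of π₃ is 2 k + 1, and index 0 does not occur.
module Even = Parts evenPart (λ k → suc (suc k * 2)) (λ _ → refl)
module Odd  = Parts oddPart  (λ k → k * 2)           (λ _ → refl)

evens odds : ℕ → Graded (List ℕ)
evens H = map (map evenPart) ∘ Even.nonempty H
odds  H = map (map oddPart)  ∘ Odd.parts 0 H

evenPart-injective : ∀ {k l} → evenPart k ≡ evenPart l → k ≡ l
evenPart-injective {k} {l} eq = ℕₚ.suc-injective (ℕₚ.*-cancelʳ-≡ (suc k) (suc l) 2 eq)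

oddPart-mono : ∀ {k l} → k ≤ l → oddPart k ≤ oddPart l
oddPart-mono k≤l = ℕₚ.pred-mono-≤ (ℕₚ.*-monoˡ-≤ 2 k≤l)

oddPart-injective : ∀ {k l} → oddPart k ≡ oddPart l → k ≡ l
oddPart-injective {zero}  {zero}  eq = refl
oddPart-injective {suc k} {suc l} eq = cong suc (ℕₚ.*-cancelʳ-≡ k l 2 (ℕₚ.suc-injective eq))

enum-evens : ∀ H → Enumerates (evens H) (λ n π → ∃[ τ ] (π ≡ map evenPart τ × Even.Nonempty H n τ))
enum-evens H = enum-map (map-injective evenPart-injective) (Even.enum-nonempty H)

enum-odds : ∀ H → Enumerates (odds H) (λ n π → ∃[ τ ] (π ≡ map oddPart τ × Odd.HasParts 0 H n τ))
enum-odds H = enum-map (map-injective oddPart-injective) (Odd.enum-parts 0 H)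

indices-bounded : ∀ (f : ℕ → ℕ) {H} → (∀ k → k ≤ f k) → ∀ τ → sum (map f τ) ≤ H → All (_≤ H) τ
indices-bounded f k≤fk []      _ = []
indices-bounded f k≤fk (k ∷ τ) s =
  ℕₚ.≤-trans (k≤fk k) (ℕₚ.m+n≤o⇒m≤o (f k) s) ∷ indices-bounded f k≤fk τ (ℕₚ.m+n≤o⇒n≤o (f k) s)

length≤sum : ∀ {π} → All (0 <_) π → length π ≤ sum π
length≤sum []      = z≤n
length≤sum (p ∷ b) = ℕₚ.+-mono-≤ p (length≤sum b)

evens-sound : ∀ {H n τ} → Even.Nonempty H n τ →
              map evenPart τ ≢ [] × PE (map evenPart τ) × sum (map evenPart τ) ≡ n
evens-sound {τ = []}    (τ≢[] , _) = contradiction refl τ≢[]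
evens-sound {τ = τ@(_ ∷ _)} (_ , _ , _ , Even.hasParts l b z s) =
  (λ ()) ,
  (record { parts-positive = Allₚ.map⁺ (All.universal (λ _ → s≤s z≤n) τ)
          ; nonincreasing  = Linkedₚ.map⁺ (Linked.map (λ i≥j → ℕₚ.*-monoˡ-≤ 2 (s≤s i≥j)) l) }
  , Allₚ.map⁺ (All.universal (λ k → divides (suc k) refl) τ)) ,
  s

evens-indices : ∀ {π} → All (0 <_) π → All (2 ∣_) π → ∃[ τ ] π ≡ map evenPart τ
evens-indices []       []                          = [] , refl
evens-indices (() ∷ _) (divides zero refl ∷ _)
evens-indices (_ ∷ p)  (divides (suc k) refl ∷ e) =
  let (τ , eq) = evens-indices p e in k ∷ τ , cong (evenPart k ∷_) eq

evens-complete : ∀ {H π} → π ≢ [] → PE π → sum π ≤ H →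
                 ∃[ τ ] (π ≡ map evenPart τ × Even.Nonempty H (sum π) τ)
evens-complete {H} π≢[] (p , e) s≤H with evens-indices (IsPartition.parts-positive p) e
... | τ , refl = τ , refl , (λ { refl → π≢[] refl }) , zeros τ , zeros≤H ,
  Even.hasParts
    (Linked.map (λ {i} {j} i≥j → ℕₚ.≤-pred (ℕₚ.*-cancelʳ-≤ (suc j) (suc i) 2 i≥j))
      (Linkedₚ.map⁻ (IsPartition.nonincreasing p)))
    (indices-bounded evenPart (λ k → ℕₚ.≤-trans (ℕₚ.n≤1+n k) (ℕₚ.m≤m*n (suc k) 2)) τ s≤H)
    refl refl
  where
  zeros≤H : zeros τ ≤ H
  zeros≤H = ℕₚ.≤-trans (length-filter (_≟ 0) τ) (ℕₚ.≤-trans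
    (ℕₚ.≤-reflexive (sym (length-map evenPart τ)))
    (ℕₚ.≤-trans (length≤sum (IsPartition.parts-positive p)) s≤H))

odd-index : ∀ {x} → 2 ∤ x → ∃[ k ] x ≡ suc (k * 2)
odd-index {zero}        2∤x = contradiction (divides 0 refl) 2∤x
odd-index {suc zero}    2∤x = 0 , refl
odd-index {suc (suc x)} 2∤x =
  let (k , eq) = odd-index {x} (λ { (divides q eq) → 2∤x (divides (suc q) (cong (_+_ 2) eq)) })
  in suc k , cong (_+_ 2) eq

2∤odd : ∀ k → 2 ∤ suc (k * 2)
2∤odd zero    (divides (suc q) ())
2∤odd (suc k) (divides (suc q) eq) = 2∤odd k (divides q (ℕₚ.suc-injective (ℕₚ.suc-injective eq)))

no-zeros : ∀ τ → zeros τ ≡ 0 → All (0 <_) τ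
no-zeros []          _ = []
no-zeros (suc k ∷ τ) z = s≤s z≤n ∷ no-zeros τ z

odds-sound : ∀ {H n τ} → Odd.HasParts 0 H n τ → PO (map oddPart τ) × sum (map oddPart τ) ≡ n
odds-sound {τ = τ} (Odd.hasParts l b z s) =
  (record { parts-positive = Allₚ.map⁺ (All.map (λ { (s≤s _) → s≤s z≤n }) (no-zeros τ z))
          ; nonincreasing  = Linkedₚ.map⁺ (Linked.map oddPart-mono l) }
  , Allₚ.map⁺ (All.map (λ { {suc k} _ → 2∤odd k }) (no-zeros τ z))) ,
  s

odds-indices : ∀ {π} → All (2 ∤_) π → ∃[ τ ] (π ≡ map oddPart τ × zeros τ ≡ 0)
odds-indices []      = [] , refl , refl
odds-indices (o ∷ p) with odd-index o
... | k , refl = let (τ , eq , z) = odds-indices p in suc k ∷ τ , cong (oddPart (suc k) ∷_) eq , z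

odds-complete : ∀ {H π} → PO π → sum π ≤ H → ∃[ τ ] (π ≡ map oddPart τ × Odd.HasParts 0 H (sum π) τ)
odds-complete {H} (p , o) s≤H with odds-indices o
... | τ , refl , z = τ , refl , Odd.hasParts
  (Linked.map reflect (Linkedₚ.map⁻ (IsPartition.nonincreasing p)))
  (indices-bounded oddPart k≤oddPart τ s≤H) z refl
  where
  k≤oddPart : ∀ k → k ≤ oddPart k
  k≤oddPart zero    = z≤n
  k≤oddPart (suc k) = s≤s (ℕₚ.m≤m*n k 2)

  reflect : ∀ {i j} → oddPart i ≥ oddPart j → i ≥ j
  reflect {i}     {zero}  _   = z≤n
  reflect {suc i} {suc j} i≥j = s≤s (ℕₚ.*-cancelʳ-≤ j i 2 (ℕₚ.≤-pred i≥j))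

distinct-complete : ∀ {H π} → PD π → sum π ≤ H → HasDistinct H (sum π) π
distinct-complete {H} {π} pd s≤H =
  pd , indices-bounded (λ k → k) (λ _ → ℕₚ.≤-refl) π (subst (_≤ H) (cong sum (sym (map-id π))) s≤H) , refl

-- Generating functions

-- Since a `Laurent` may repeat exponents, a coefficient is the enumerating list itself with every
-- object replaced by its monomial. Concatenation thus becomes `⊕`, and a cartesian product with
-- additive weights becomes `⊗`.
gf : (A → ℤ) → Graded A → Series
gf w X n = map (λ a → w a , 1ℤ) (X n)

≡⇒≋ : ∀ {a b} → a ≡ b → a ≋ b
≡⇒≋ refl = L.refl

gf-cong : ∀ {w w′ : A → ℤ} (X : Graded A) n → (∀ {a} → a ∈ X n → w a ≡ w′ a) →
          gf w X n ≡ gf w′ X n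
gf-cong X n w≡ = map-cong-local (All.tabulate (λ a∈ → cong (_, 1ℤ) (w≡ a∈)))

gf-map : ∀ (w : B → ℤ) (f : A → B) (X : Graded A) n → gf w (map f ∘ X) n ≡ gf (w ∘ f) X n
gf-map w f X n = sym (map-∘ (X n))

scale-gf : ∀ {w w′ : A → ℤ} e (xs : List A) → (∀ {a} → a ∈ xs → w a ≡ e ℤ.+ w′ a) →
           map (λ a → w a , 1ℤ) xs ≡ scale (e , 1ℤ) (map (λ a → w′ a , 1ℤ) xs)
scale-gf e []       w≡ = refl
scale-gf e (a ∷ xs) w≡ = cong₂ _∷_ (cong (_, 1ℤ) (w≡ (here refl))) (scale-gf e xs (w≡ ∘ there))

monomial-* : ∀ i s f n → (z^[ i ]q^[ s ] *ₛ f) n ≋ shift s (scale (i , 1ℤ) ∘ f) n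
monomial-* i zero    f zero    = L.+-identityʳ (scale (i , 1ℤ) (f 0))
monomial-* i zero    f (suc n) = L.trans
  (L.+-cong (L.+-identityʳ (scale (i , 1ℤ) (f (suc n)))) (*ₛ-zeroˡ n f))
  (L.+-identityʳ (scale (i , 1ℤ) (f (suc n))))
monomial-* i (suc s) f zero    = L.refl
monomial-* i (suc s) f (suc n) = monomial-* i s f n

gf-shift : ∀ {w : B → ℤ} {w′ : A → ℤ} {c : A → B} e s X →
           (∀ {n a} → a ∈ X n → w (c a) ≡ e ℤ.+ w′ a) → ∀ n →
           gf w (shift s (map c ∘ X)) n ≋ (z^[ e ]q^[ s ] *ₛ gf w′ X) n
gf-shift {w = w} {w′} {c} e s X w≡ n = L.trans (≡⇒≋ (go s n)) (L.sym (monomial-* e s (gf w′ X) n))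
  where
  go : ∀ s n → gf w (shift s (map c ∘ X)) n ≡ shift s (scale (e , 1ℤ) ∘ gf w′ X) n
  go zero    n       = trans (gf-map w c X n) (scale-gf e (X n) w≡)
  go (suc s) zero    = refl
  go (suc s) (suc n) = go s n

gf-⊞ : ∀ (w : A → ℤ) X Y n → gf w (X ⊞ Y) n ≡ gf w X n ⊕ gf w Y n
gf-⊞ w X Y n = map-++ _ (X n) (Y n)

gf-⊞-shift : ∀ {w : B → ℤ} {w′ : A → ℤ} {c : A → B} X e s Y →
             (∀ {n a} → a ∈ Y n → w (c a) ≡ e ℤ.+ w′ a) → ∀ n →
             gf w (X ⊞ shift s (map c ∘ Y)) n ≋ (gf w X +ₛ z^[ e ]q^[ s ] *ₛ gf w′ Y) n
gf-⊞-shift {w = w} {c = c} X e s Y w≡ n = L.trans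
  (≡⇒≋ (gf-⊞ w X (shift s (map c ∘ Y)) n))
  (L.+-congˡ {gf w X n} (gf-shift e s Y w≡ n))

gf-geometric : ∀ {w : A → ℤ} {c} e s X → (∀ a → w (c a) ≡ e ℤ.+ w a) → ∀ n →
               gf w (geometric s c X) n ≋
               (gf w X +ₛ z^[ e ]q^[ suc s ] *ₛ gf w (geometric s c X)) n
gf-geometric {w = w} {c} e s X w≡ n = L.trans
  (≡⇒≋ (cong (map _) (geometric-unfold s c X n)))
  (gf-⊞-shift X e (suc s) (geometric s c X) (λ {_} {a} _ → w≡ a) n)

gf-shift-unit : ∀ (w : A → ℤ) s b n → gf w (shift s (unit b)) n ≡ z^[ w b ]q^[ s ] n
gf-shift-unit w zero    b zero    = refl
gf-shift-unit w zero    b (suc n) = refl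
gf-shift-unit w (suc s) b zero    = refl
gf-shift-unit w (suc s) b (suc n) = gf-shift-unit w s b n

gf-× : ∀ {w : A × B → ℤ} {u : A → ℤ} {v : B → ℤ} xs ys →
       (∀ {a b} → a ∈ xs → b ∈ ys → w (a , b) ≡ u a ℤ.+ v b) →
       map (λ ab → w ab , 1ℤ) (cartesianProduct xs ys) ≡
       map (λ a → u a , 1ℤ) xs ⊗ map (λ b → v b , 1ℤ) ys
gf-× []       ys w≡ = refl
gf-× {w = w} {u} (a ∷ xs) ys w≡ = trans (map-++ _ (map (a ,_) ys) _) (cong₂ _++_
  (trans (sym (map-∘ ys)) (scale-gf (u a) ys (w≡ (here refl))))
  (gf-× xs ys (w≡ ∘ there)))

gf-⊠ : ∀ {w : A × B → ℤ} {u : A → ℤ} {v : B → ℤ} X Y →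
       (∀ {i j a b} → a ∈ X i → b ∈ Y j → w (a , b) ≡ u a ℤ.+ v b) →
       ∀ n → gf w (X ⊠ Y) n ≡ (gf u X *ₛ gf v Y) n
gf-⊠ X Y w≡ zero    = gf-× (X 0) (Y 0) w≡
gf-⊠ X Y w≡ (suc n) = trans (map-++ _ (cartesianProduct (X 0) (Y (suc n))) _)
  (cong₂ _++_ (gf-× (X 0) (Y (suc n)) w≡) (gf-⊠ (X ∘ suc) Y w≡ n))

count : ∀ (w : A → ℤ) m xs →
        coeff (map (λ a → w a , 1ℤ) xs) m ≡ + length (filter (λ a → w a ℤ.≟ m) xs)
count w m []       = refl
count w m (a ∷ xs) with does (w a ℤ.≟ m)
... | true  = cong (ℤ._+_ 1ℤ) (count w m xs)
... | false = trans (ℤₚ.+-identityˡ _) (count w m xs)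

-- Evaluating the crank and κ

crank-ω : ∀ {k} π → ω π ≡ k →
          crank π ≡ (if does (k ≟ 0) then + ℓ π else length (filter (k <?_) π) ⊖ k)
-- With `ω π` generalised to `k`, a known number of ones selects the branch of the crank.
crank-ω π refl = refl

ω-map-suc : ∀ τ → ω (map suc τ) ≡ zeros τ
ω-map-suc []          = refl
ω-map-suc (zero ∷ τ)  = cong suc (ω-map-suc τ)
ω-map-suc (suc _ ∷ τ) = ω-map-suc τ

ℓ≤ : ∀ {k π} → All (_≤ k) π → ℓ π ≤ k
ℓ≤ []      = z≤n
ℓ≤ (p ∷ b) = ℕₚ.⊔-lub p (ℓ≤ b)

ℓ-∷ : ∀ {k π} → All (_≤ k) π → ℓ (k ∷ π) ≡ k
ℓ-∷ b = ℕₚ.m≥n⇒m⊔n≡m (ℓ≤ b)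

half-evenPart : ∀ τ → half (map evenPart τ) ≡ map suc τ
half-evenPart []      = refl
half-evenPart (k ∷ τ) = cong₂ _∷_ (m*n/n≡m (suc k) 2) (half-evenPart τ)

-- On a partition with j + 1 ones this is the crank, and it is additive in the
-- other parts.
onesWeight : ℕ → List ℕ → ℤ
onesWeight j τ = length (filter (suc j <?_) (map suc τ)) ⊖ suc j

onesWeight-small : ∀ {j K} → K < j → ∀ τ → onesWeight j (suc K ∷ τ) ≡ 0ℤ ℤ.+ onesWeight j τ
onesWeight-small {j} {K} K<j τ = trans
  (cong (λ xs → length xs ⊖ suc j) (filter-reject (suc j <?_) (ℕₚ.≤⇒≯ (s≤s K<j))))
  (sym (ℤₚ.+-identityˡ _))

onesWeight-large : ∀ {j K} → j ≤ K → ∀ τ → onesWeight j (suc K ∷ τ) ≡ 1ℤ ℤ.+ onesWeight j τ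
onesWeight-large {j} {K} j≤K τ = trans
  (cong (λ xs → length xs ⊖ suc j) (filter-accept (suc j <?_) (s≤s (s≤s j≤K))))
  (sym (1+-⊖ (length (filter (suc j <?_) (map suc τ))) (suc j)))
  where
  1+-⊖ : ∀ m n → 1ℤ ℤ.+ (m ⊖ n) ≡ suc m ⊖ n
  1+-⊖ m n = trans (ℤₚ.+-comm 1ℤ (m ⊖ n))
    (trans (ℤₚ.distribˡ-⊖-+-pos 1 m n) (cong (_⊖ n) (ℕₚ.+-comm m 1)))

-- The exponent is left as a product to agree with the one that `monomial-^` gives for the power
-- `suc j` of `z⁻¹ q²`.
onesWeight-replicate : ∀ j → onesWeight j (replicate (suc j) 0) ≡ + suc j ℤ.* -1ℤ
onesWeight-replicate j = trans
  (cong (λ xs → length xs ⊖ suc j)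
    (filter-none (suc j <?_) (Allₚ.map⁺ (Allₚ.replicate⁺ {P = λ k → ¬ suc j < suc k} {x = 0} (suc j) λ { (s≤s ()) }))))
  (trans (sym (ℤₚ.-1*i≡-i (+ suc j))) (ℤₚ.*-comm -1ℤ (+ suc j)))

-- This is `κ` extended by 0 to the empty partition, as `crank2` prescribes when `π₂` is empty.
κ₀ : List ℕ → ℤ
κ₀ π = crank2-parts π []

private
  _∈ℕ?_ : ∀ k (π : List ℕ) → Dec (k ∈ π)
  _∈ℕ?_ = ∈?-from _≟_

gap : ∀ {k i τ} → All (_≤ suc k) τ → 2 + k ≤ i → i < 4 + k → ¬ i ∈ 4 + k ∷ τ
gap b _     i< (here refl) = ℕₚ.<-irrefl refl i<
gap b 2+k≤i _  (there i∈)  = ℕₚ.<-irrefl refl (ℕₚ.≤-trans 2+k≤i (All.lookup b i∈))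

-- Under the largest part `4 + k`, the next part is at most `1 + k`, equal to `2 + k`, or equal to
-- `3 + k`. This lemma and the next two settle these cases, which give the three summands of
-- `G-suc`.
κ-isolated : ∀ {k τ} → All (_≤ suc k) τ → κ₀ (4 + k ∷ τ) ≡ 1ℤ
κ-isolated {k} {τ} b
  rewrite ℓ-∷ {4 + k} {τ} (All.map (λ i≤ → ℕₚ.≤-trans i≤ (ℕₚ.m≤n+m (suc k) 3)) b)
        | dec-false ((3 + k) ∈ℕ? (4 + k ∷ τ)) (gap b (ℕₚ.n≤1+n (2 + k)) ℕₚ.≤-refl)
        | dec-false ((2 + k) ∈ℕ? (4 + k ∷ τ)) (gap b ℕₚ.≤-refl (ℕₚ.n≤1+n (3 + k))) = refl

κ-next : ∀ {k τ} → All (_≤ suc k) τ → κ₀ (4 + k ∷ 2 + k ∷ τ) ≡ 0ℤ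
κ-next {k} {τ} b
  rewrite ℓ-∷ {4 + k} {2 + k ∷ τ} (ℕₚ.m≤n+m (2 + k) 2 ∷ All.map (λ i≤ → ℕₚ.≤-trans i≤ (ℕₚ.m≤n+m (suc k) 3)) b)
        | dec-true ((2 + k) ∈ℕ? (4 + k ∷ 2 + k ∷ τ)) (there (here refl))
        -- Whether `3 + k` is a part need not be decided: the second disjunct already holds.
        | ∨-zeroʳ (does ((3 + k) ∈ℕ? (4 + k ∷ 2 + k ∷ τ))) = refl

κ-consecutive : ∀ {k τ} → All (_≤ 2 + k) τ → κ₀ (4 + k ∷ 3 + k ∷ τ) ≡ 0ℤ
κ-consecutive {k} {τ} b
  rewrite ℓ-∷ {4 + k} {3 + k ∷ τ} (ℕₚ.n≤1+n (3 + k) ∷ All.map (λ i≤ → ℕₚ.≤-trans i≤ (ℕₚ.m≤n+m (2 + k) 2)) b)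
        | dec-true ((3 + k) ∈ℕ? (4 + k ∷ 3 + k ∷ τ)) (there (here refl)) = refl

-- Monomials modulo q^(N+1)

module Modulo (N : ℕ) where
  private
    module S = CommutativeRing (seriesRing N)
  open QAlgebra (seriesRing N)
  open import Algebra.Properties.Semiring.Exp S.semiring using (_^_)

  pointwise : ∀ {f g : Series} → (∀ n → f n ≋ g n) → f S.≈ g
  pointwise p = upTo λ n _ → p n

  monomial-cong : ∀ {i j s t} → i ≡ j → s ≡ t → z^[ i ]q^[ s ] S.≈ z^[ j ]q^[ t ]
  monomial-cong refl refl = S.refl

  monomials-* : ∀ i s j t → z^[ i ]q^[ s ] *ₛ z^[ j ]q^[ t ] S.≈ z^[ i ℤ.+ j ]q^[ s + t ]
  monomials-* i s j t = pointwise λ n → L.trans (monomial-* i s z^[ j ]q^[ t ] n) (≡⇒≋ (go s n))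
    where
    go : ∀ s n → shift s (scale (i , 1ℤ) ∘ z^[ j ]q^[ t ]) n ≡ z^[ i ℤ.+ j ]q^[ s + t ] n
    go zero    n with does (n ≟ t)
    ... | true  = refl
    ... | false = refl
    go (suc s) zero    = refl
    go (suc s) (suc n) = go s n

  monomial-^ : ∀ i s k → z^[ i ]q^[ s ] ^ k S.≈ z^[ + k ℤ.* i ]q^[ k * s ]
  monomial-^ i s zero    = S.refl
  monomial-^ i s (suc k) = S.trans (S.*-congˡ {z^[ i ]q^[ s ]} (monomial-^ i s k))
    (S.trans (monomials-* i s (+ k ℤ.* i) (k * s))
             (monomial-cong (sym (ℤₚ.suc-* (+ k) i)) refl))

  monomial-0 : ∀ i {s} → N < s → z^[ i ]q^[ s ] S.≈ S.0#
  monomial-0 i {s} N<s = upTo λ n n≤N → ≡⇒≋ (go n n≤N)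
    where
    go : ∀ n → n ≤ N → z^[ i ]q^[ s ] n ≡ 𝟘
    go n n≤N = cong (λ b → if b then [ (i , 1ℤ) ] else 𝟘)
      (dec-false (n ≟ s) λ { refl → ℕₚ.<⇒≱ N<s n≤N })

  zₛ z⁻¹ₛ : Series
  zₛ   = z^[ 1ℤ ]q^[ 0 ]
  z⁻¹ₛ = z^[ -1ℤ ]q^[ 0 ]

  q-^ : ∀ k → q ^ k S.≈ z^[ 0ℤ ]q^[ k ]
  q-^ k = S.trans (monomial-^ 0ℤ 1 k) (monomial-cong (ℤₚ.*-zeroʳ (+ k)) (ℕₚ.*-identityʳ k))

  q²-^ : ∀ k → q² ^ k S.≈ z^[ 0ℤ ]q^[ k * 2 ]
  q²-^ k = S.trans (monomial-^ 0ℤ 2 k) (monomial-cong (ℤₚ.*-zeroʳ (+ k)) refl)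

  -- The abstract identities contain the product of `z` and `p`, whereas `zq²` and `z⁻¹q²` are
  -- single monomials.
  zq : ∀ i s → z^[ i ]q^[ 0 ] *ₛ z^[ 0ℤ ]q^[ s ] S.≈ z^[ i ]q^[ s ]
  zq i s = S.trans (monomials-* i 0 0ℤ s) (monomial-cong (ℤₚ.+-identityʳ i) refl)

-- The weighted enumeration of overpartitions

pairs : ℕ → Graded (List ℕ × List ℕ)
-- Separating the case of empty `π₂` makes the weight depend on `π₁` alone in the first summand and
-- on `π₂` alone in the second.
pairs H = map ([] ,_) ∘ distinct (suc H) ⊞ evens H ⊠ distinct (suc H)

triples : ℕ → Graded ((List ℕ × List ℕ) × List ℕ)
triples H = pairs H ⊠ odds (suc H)

crank2ₚ : List ℕ × List ℕ → ℤ
crank2ₚ (π₂ , π₁) = crank2-parts π₁ π₂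

no-weight : ∀ {A : Set} → A → ℤ
no-weight _ = 0ℤ

module GeneratingFunction (N : ℕ) where
  private
    module S = CommutativeRing (seriesRing N)
    -- Then `q² ^ H` vanishes modulo q^(N+1), even for `N = 0`, and `suc H` is the bound `2 + N`
    -- occurring in the kappa identity for `K = N`.
    H = suc N
  open QAlgebra (seriesRing N)
  open import Algebra.Properties.Semiring.Exp S.semiring using (_^_; ^-congˡ)
  open Modulo N

  U O Nₛ Pₛ Dₛ G : ℕ → Series
  W : ℕ → ℕ → Series
  crankᵢ : List ℕ → ℤ
  crankᵢ τ = crank (map suc τ)
  U K  = gf no-weight (Even.parts 0 K)
  W j K = gf (onesWeight j) (Even.parts (suc j) K)
  Nₛ K = gf crankᵢ (Even.noOnes K)
  O j  = gf crankᵢ (Even.withOnes H j)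
  Pₛ K  = gf no-weight (Odd.parts 0 K)
  Dₛ K  = gf no-weight (distinct K)
  G K  = gf κ₀ (distinct K)

  gf-unit : ∀ {A : Set} (w : A → ℤ) b → gf w (unit b) S.≈ z^[ w b ]q^[ 0 ]
  gf-unit w b = pointwise λ n → ≡⇒≋ (gf-shift-unit w 0 b n)

  q²^ : ∀ k f → z^[ 0ℤ ]q^[ k * 2 ] *ₛ f S.≈ q² ^ k *ₛ f
  q²^ k f = S.*-congʳ {f} (S.sym (q²-^ k))

  zq²-^ : ∀ k → (zₛ *ₛ q²) ^ k S.≈ z^[ + k ]q^[ k * 2 ]
  zq²-^ k = S.trans (^-congˡ k (zq 1ℤ 2))
    (S.trans (monomial-^ 1ℤ 2 k) (monomial-cong (ℤₚ.*-identityʳ (+ k)) refl))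

  U-zero : U 0 S.≈ S.1#
  U-zero = gf-unit no-weight []

  U-suc : ∀ K → U (suc K) S.≈ U K +ₛ q² ^ suc (suc K) *ₛ U (suc K)
  U-suc K = S.trans (pointwise (gf-geometric 0ℤ _ (Even.parts 0 K) (λ _ → refl)))
    (S.+-congˡ {U K} (q²^ (2 + K) (U (suc K))))

  W-zero : ∀ j → W j 0 S.≈ (z⁻¹ₛ *ₛ q²) ^ suc j
  W-zero j = S.trans (pointwise λ n → ≡⇒≋ (gf-shift-unit (onesWeight j) (suc j * 2) (replicate (suc j) 0) n))
    (S.trans (monomial-cong (onesWeight-replicate j) refl)
      (S.sym (S.trans (^-congˡ (suc j) (zq -1ℤ 2)) (monomial-^ -1ℤ 2 (suc j)))))

  W-small : ∀ j K → K < j → W j (suc K) S.≈ W j K +ₛ q² ^ suc (suc K) *ₛ W j (suc K)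
  W-small j K K<j = S.trans
    (pointwise (gf-geometric 0ℤ _ (Even.parts (suc j) K) (onesWeight-small K<j)))
    (S.+-congˡ {W j K} (q²^ (2 + K) (W j (suc K))))

  W-large : ∀ j K → j ≤ K → W j (suc K) S.≈ W j K +ₛ (zₛ *ₛ q²) *ₛ q² ^ suc K *ₛ W j (suc K)
  W-large j K j≤K = S.trans
    (pointwise (gf-geometric 1ℤ _ (Even.parts (suc j) K) (onesWeight-large j≤K)))
    (S.+-congˡ {W j K} (S.*-congʳ {W j (suc K)} (S.sym
      (S.trans (S.*-assoc zₛ q² (q² ^ suc K))
        (S.trans (S.*-congˡ {zₛ} (q²-^ (2 + K))) (zq 1ℤ ((2 + K) * 2)))))))

  N-zero : Nₛ 0 S.≈ S.0#
  N-zero = S.refl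

  N-suc : ∀ K → Nₛ (suc K) S.≈ Nₛ K +ₛ (zₛ *ₛ q²) ^ suc (suc K) *ₛ U (suc K)
  N-suc K = S.trans
    (pointwise (gf-⊞-shift (Even.noOnes K) (+ (2 + K)) ((2 + K) * 2) (Even.parts 0 (suc K)) (λ {n} → weight {n})))
    (S.+-congˡ {Nₛ K} (S.*-congʳ {U (suc K)} (S.sym (zq²-^ (2 + K)))))
    where
    -- The largest part alone fixes the crank here, so the remaining parts are counted by `U`
    -- without weight.
    weight : ∀ {n τ} → τ ∈ Even.parts 0 (suc K) n → crankᵢ (suc K ∷ τ) ≡ + (2 + K) ℤ.+ 0ℤ
    weight {n} {τ} τ∈ with sound (Even.enum-parts 0 (suc K)) {n} τ∈
    ... | Even.hasParts _ b z _ = trans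
      (crank-ω (map suc (suc K ∷ τ)) (trans (ω-map-suc τ) z))
      (trans (cong +_ (ℓ-∷ (Allₚ.map⁺ (All.map s≤s b)))) (sym (ℤₚ.+-identityʳ (+ (2 + K)))))

  O-zero : O 0 S.≈ S.0#
  O-zero = S.refl

  O-suc : ∀ j → O (suc j) S.≈ O j +ₛ W j H
  O-suc j = pointwise λ n → L.trans
    (≡⇒≋ (gf-⊞ crankᵢ (Even.withOnes H j) (Even.parts (suc j) H) n))
    (L.+-congˡ {O j n} (≡⇒≋ (gf-cong (Even.parts (suc j) H) n (weight {n}))))
    where
    weight : ∀ {n τ} → τ ∈ Even.parts (suc j) H n → crankᵢ τ ≡ onesWeight j τ
    weight {n} {τ} τ∈ = crank-ω (map suc τ)
      (trans (ω-map-suc τ) (Even.HasParts.zeros≡ (sound (Even.enum-parts (suc j) H) {n} τ∈)))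

  Pₛ-suc : ∀ K → Pₛ (suc K) S.≈ Pₛ K +ₛ q *ₛ q² ^ K *ₛ Pₛ (suc K)
  Pₛ-suc K = S.trans (pointwise (gf-geometric 0ℤ _ (Odd.parts 0 K) (λ _ → refl)))
    (S.+-congˡ {Pₛ K} (S.*-congʳ {Pₛ (suc K)} (S.sym
      (S.trans (S.*-congˡ {q} (q²-^ K)) (monomials-* 0ℤ 1 0ℤ (K * 2))))))

  gf-distinct-suc : ∀ w K → gf w (distinct (suc K)) S.≈
                    gf w (distinct K) +ₛ q ^ suc K *ₛ gf (w ∘ (suc K ∷_)) (distinct K)
  gf-distinct-suc w K = S.trans
    (pointwise (gf-⊞-shift (distinct K) 0ℤ (suc K) (distinct K) (λ _ → sym (ℤₚ.+-identityˡ _))))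
    (S.+-congˡ {gf w (distinct K)} (S.*-congʳ {gf (w ∘ (suc K ∷_)) (distinct K)} (S.sym (q-^ (suc K)))))

  gf-const : ∀ {w} e K → (∀ {n τ} → HasDistinct K n τ → w τ ≡ e) →
             gf w (distinct K) S.≈ z^[ e ]q^[ 0 ] *ₛ Dₛ K
  gf-const {w} e K w≡ = pointwise λ n → L.trans
    (≡⇒≋ (scale-gf e (distinct K n)
            (λ τ∈ → trans (w≡ (sound (enum-distinct K) τ∈)) (sym (ℤₚ.+-identityʳ e)))))
    (L.sym (monomial-* e 0 (Dₛ K) n))

  gf-zero : ∀ {w} K → (∀ {n τ} → HasDistinct K n τ → w τ ≡ 0ℤ) → gf w (distinct K) S.≈ Dₛ K
  gf-zero K w≡ = S.trans (gf-const 0ℤ K w≡) (S.*-identityˡ (Dₛ K))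

  -- Only the empty partition and the partition 1 remain, so the exceptional small values of `κ` are
  -- obtained by computation.
  gf-distinct-1 : ∀ w → gf w (distinct 1) S.≈ z^[ w [] ]q^[ 0 ] +ₛ q *ₛ z^[ w [ 1 ] ]q^[ 0 ]
  gf-distinct-1 w = S.trans (gf-distinct-suc w 0)
    (S.+-cong (gf-unit w [])
      (S.*-cong {q ^ 1} {q} (S.*-identityʳ q) (gf-unit (w ∘ (1 ∷_)) [])))

  Dₛ-zero : Dₛ 0 S.≈ S.1#
  Dₛ-zero = gf-unit no-weight []

  Dₛ-suc : ∀ K → Dₛ (suc K) S.≈ Dₛ K +ₛ q ^ suc K *ₛ Dₛ K
  Dₛ-suc = gf-distinct-suc no-weight

  G-one : G 1 S.≈ Dₛ 1
  G-one = S.trans (gf-distinct-1 κ₀) (S.sym (gf-distinct-1 no-weight))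

  G-two : G 2 S.≈ G 1 +ₛ q ^ 2 *ₛ (zₛ +ₛ q)
  G-two = S.trans (gf-distinct-suc κ₀ 1) (S.+-congˡ {G 1} (S.*-congˡ {q ^ 2}
    (S.trans (gf-distinct-1 (κ₀ ∘ (2 ∷_))) (S.+-congˡ {zₛ} (S.*-identityʳ q)))))

  G-three : G 3 S.≈ G 2 +ₛ q ^ 3 *ₛ ((zₛ +ₛ q) +ₛ q ^ 2 *ₛ Dₛ 1)
  G-three = S.trans (gf-distinct-suc κ₀ 2) (S.+-congˡ {G 2} (S.*-congˡ {q ^ 3}
    (S.trans (gf-distinct-suc (κ₀ ∘ (3 ∷_)) 1) (S.+-cong
      (S.trans (gf-distinct-1 (κ₀ ∘ (3 ∷_))) (S.+-congˡ {zₛ} (S.*-identityʳ q)))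
      (S.*-congˡ {q ^ 2} (S.trans (gf-distinct-1 (κ₀ ∘ (3 ∷_) ∘ (2 ∷_)))
                                  (S.sym (gf-distinct-1 no-weight))))))))

  G-suc : ∀ K → let M = suc K in
          G (3 + M) S.≈ G (2 + M) +ₛ
            q ^ (3 + M) *ₛ (zₛ *ₛ Dₛ M +ₛ q ^ (1 + M) *ₛ Dₛ M +ₛ q ^ (2 + M) *ₛ Dₛ (1 + M))
  G-suc K = S.trans (gf-distinct-suc κ₀ (2 + M)) (S.+-congˡ {G (2 + M)} (S.*-congˡ {q ^ (3 + M)}
    (S.trans (gf-distinct-suc (κ₀ ∘ (3 + M ∷_)) (1 + M)) (S.+-cong
      (S.trans (gf-distinct-suc (κ₀ ∘ (3 + M ∷_)) M) (S.+-cong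
        (gf-const 1ℤ M (λ (_ , b , _) → κ-isolated b))
        (S.*-congˡ {q ^ (1 + M)} (gf-zero M (λ (_ , b , _) → κ-next b)))))
      (S.*-congˡ {q ^ (2 + M)} (gf-zero (1 + M) (λ (_ , b , _) → κ-consecutive b)))))))
    where M = suc K

  C : Series
  C = Nₛ H +ₛ O H

  q^-zero : ∀ {k} → N < k → q ^ k S.≈ S.0#
  q^-zero N<k = S.trans (q-^ _) (monomial-0 0ℤ N<k)

  q²^H≈0 : q² ^ H S.≈ S.0#
  q²^H≈0 = S.trans (q²-^ H) (monomial-0 0ℤ (ℕₚ.m≤m*n H 2))

  z*z⁻¹ : zₛ *ₛ z⁻¹ₛ S.≈ S.1#
  z*z⁻¹ = monomials-* 1ℤ 0 -1ℤ 0

  crank-gf : ((1- q²) +ₛ zₛ *ₛ q² +ₛ C) *ₛ (poch (zₛ *ₛ q²) q² (suc H) *ₛ poch (z⁻¹ₛ *ₛ q²) q² (suc H))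
             S.≈ poch q² q² (suc H)
  crank-gf = Crank.crank-identity q² zₛ z⁻¹ₛ H q²^H≈0 z*z⁻¹ U Nₛ O W
    U-zero U-suc W-zero W-small W-large N-zero N-suc O-zero O-suc

  kappa-gf : G (suc H) +ₛ q² *ₛ Dₛ N S.≈ Dₛ (suc H) +ₛ zₛ *ₛ q² *ₛ Dₛ N
  kappa-gf = S.trans (S.+-congˡ {G (suc H)} (S.*-congʳ {Dₛ N} (S.sym (q-^ 2))))
    (S.trans (Kappa.kappa-identity q zₛ Dₛ G Dₛ-zero Dₛ-suc G-one G-two G-three G-suc N)
      (S.+-congˡ {Dₛ (suc H)} (S.*-congʳ {Dₛ N} (S.*-congˡ {zₛ} (q-^ 2)))))

  Dₛ-stable : Dₛ N S.≈ Dₛ (suc H)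
  Dₛ-stable = S.sym (S.trans (step H (ℕₚ.n≤1+n N)) (step N ℕₚ.≤-refl))
    where
    step : ∀ K → N ≤ K → Dₛ (suc K) S.≈ Dₛ K
    step K N≤K = S.trans (Dₛ-suc K) (S.trans (S.+-congˡ {Dₛ K}
      (S.trans (S.*-congʳ {Dₛ K} (q^-zero (s≤s N≤K))) (S.zeroˡ (Dₛ K)))) (S.+-identityʳ (Dₛ K)))

  -- `evens` lists no empty partition, so the clause of `crank2-parts` for non-empty `π₂` applies.
  crank-evens : ∀ {n π₂} π₁ → π₂ ∈ evens H n → crank2ₚ (π₂ , π₁) ≡ crank (half π₂)
  crank-evens {n} π₁ π₂∈ with ∈-map⁻ (map evenPart) π₂∈
  ... | []    , τ∈ , refl = contradiction refl (proj₁ (sound (Even.enum-nonempty H) {n} τ∈))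
  ... | _ ∷ _ , τ∈ , refl = refl

  evens-gf : ∀ n → gf (crank ∘ half) (evens H) n ≡ C n
  evens-gf n = trans (gf-map (crank ∘ half) (map evenPart) (Even.nonempty H) n)
    (trans (gf-cong (Even.nonempty H) n (λ {τ} _ → cong crank (half-evenPart τ)))
           (gf-⊞ crankᵢ (Even.noOnes H) (Even.withOnes H H) n))

  T : Series
  T = gf (crank2ₚ ∘ proj₁) (triples H)

  T-gf : T S.≈ (G (suc H) +ₛ C *ₛ Dₛ (suc H)) *ₛ Pₛ (suc H)
  T-gf = S.trans
    (pointwise λ n → ≡⇒≋ (gf-⊠ {u = crank2ₚ} {v = no-weight} (pairs H) (odds (suc H))
                            (λ _ _ → sym (ℤₚ.+-identityʳ _)) n))
    (S.*-cong
      (pointwise λ n → L.trans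
        (≡⇒≋ (gf-⊞ crank2ₚ (map ([] ,_) ∘ distinct (suc H)) (evens H ⊠ distinct (suc H)) n))
        (L.+-cong (≡⇒≋ (gf-map crank2ₚ ([] ,_) (distinct (suc H)) n))
          (L.trans (≡⇒≋ (gf-⊠ {u = crank ∘ half} {v = no-weight} (evens H) (distinct (suc H))
                      (λ {i} {_} {_} {π₁} π₂∈ _ → trans (crank-evens {i} π₁ π₂∈) (sym (ℤₚ.+-identityʳ _))) n))
            (*ₛ-cong n (λ i _ → ≡⇒≋ (evens-gf i)) (λ _ _ → L.refl)))))
      (pointwise λ n → ≡⇒≋ (gf-map no-weight (map oddPart) (Odd.parts 0 (suc H)) n)))

  ^ₛ≡^ : ∀ f k → f ^ₛ k ≡ f ^ k
  ^ₛ≡^ f zero    = refl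
  ^ₛ≡^ f (suc k) = cong (f *ₛ_) (^ₛ≡^ f k)

  ⟨⨾⟩≡poch : ∀ a p k → ⟨ a ⨾ p ⟩ k ≡ poch a p k
  ⟨⨾⟩≡poch a p zero    = refl
  ⟨⨾⟩≡poch a p (suc k) = cong₂ (λ f g → f *ₛ (one -ₛ a *ₛ g)) (⟨⨾⟩≡poch a p k) (^ₛ≡^ p k)

  -- The coefficient of qⁿ is settled by the first `n + 1` factors, and `suc H` factors are enough
  -- for every `n ≤ N`.
  ⟨⨾⟩∞≈poch : ∀ a p → p 0 ≈ 𝟘 → ⟨ a ⨾ p ⟩∞ S.≈ poch a p (suc H)
  ⟨⨾⟩∞≈poch a p p₀≈0 = upTo λ n n≤N → wrap λ m → sym (trans
    (cong (λ f → coeff (f n) m) (trans (sym (⟨⨾⟩≡poch a p (suc H)))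
      (cong ⟨ a ⨾ p ⟩ (sym (ℕₚ.m∸n+n≡m (s≤s (ℕₚ.m≤n⇒m≤1+n n≤N)))))))
    (⟨⨾⟩-limit a p p₀≈0 n (suc H ℕ.∸ suc n) m))

  denominator≈ : M2-denominator S.≈
    poch q q² (suc H) *ₛ poch (zₛ *ₛ q²) q² (suc H) *ₛ poch (z⁻¹ₛ *ₛ q²) q² (suc H)
  denominator≈ = S.*-cong (S.*-cong
    (⟨⨾⟩∞≈poch q q² (λ _ → refl))
    (S.trans (⟨⨾⟩∞≈poch zq² q² (λ _ → refl)) (poch-cong q² (suc H) (S.sym (zq 1ℤ 2)))))
    (S.trans (⟨⨾⟩∞≈poch z⁻¹q² q² (λ _ → refl)) (poch-cong q² (suc H) (S.sym (zq -1ℤ 2))))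

  numerator≈ : M2-numerator S.≈ Dₛ (suc H) *ₛ poch q² q² (suc H)
  numerator≈ = S.*-cong
    (S.trans (⟨⨾⟩∞≈poch (minus q) q (λ _ → refl))
             (S.sym (distinct-poch Dₛ Dₛ-zero Dₛ-suc (suc H))))
    (⟨⨾⟩∞≈poch q² q² (λ _ → refl))

  -- Comparison after multiplication by the denominator spares any expansion of its reciprocal.
  T≈M2 : T S.≈ M2-series
  T≈M2 = quotient-unique (pointwise λ n → wrap (M2-denominator-inverse n))
    (S.trans (S.*-cong T-gf denominator≈)
      (S.trans (combine {B = Pₛ (suc H)} (partition-poch Pₛ (gf-unit no-weight []) Pₛ-suc (suc H))
                  Dₛ-stable kappa-gf crank-gf)
        (S.sym numerator≈)))

-- Overpartitions

module _ (H : ℕ) where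
  Evens : ℕ → List ℕ → Set
  Evens n π = ∃[ τ ] (π ≡ map evenPart τ × Even.Nonempty H n τ)

  Odds : ℕ → List ℕ → Set
  Odds n π = ∃[ τ ] (π ≡ map oddPart τ × Odd.HasParts 0 (suc H) n τ)

  Pair : ℕ → List ℕ × List ℕ → Set
  Pair n π₂₁ = (∃[ π₁ ] (π₂₁ ≡ ([] , π₁) × HasDistinct (suc H) n π₁))
             ⊎ (∃[ i ] ∃[ j ] (i + j ≡ n × Evens i (proj₁ π₂₁) × HasDistinct (suc H) j (proj₂ π₂₁)))

  Triple : ℕ → (List ℕ × List ℕ) × List ℕ → Set
  Triple n t = ∃[ i ] ∃[ j ] (i + j ≡ n × Pair i (proj₁ t) × Odds j (proj₂ t))

  Evens-sum : ∀ {n π} → Evens n π → sum π ≡ n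
  Evens-sum (_ , refl , ne) = proj₂ (proj₂ (evens-sound ne))

  Pair-sum : ∀ {n π₂₁} → Pair n π₂₁ → sum (proj₁ π₂₁) + sum (proj₂ π₂₁) ≡ n
  Pair-sum (inj₁ (_ , refl , _ , _ , s))        = s
  Pair-sum (inj₂ (_ , _ , refl , e , _ , _ , s)) = cong₂ _+_ (Evens-sum e) s

  enum-pairs : Enumerates (pairs H) Pair
  enum-pairs = enum-⊞
    (λ { (_ , refl , _) (_ , _ , _ , (_ , eq , ne) , _) → proj₁ (evens-sound ne) (sym eq) })
    (enum-map Productₚ.,-injectiveʳ (enum-distinct (suc H)))
    (enum-⊠ (λ e e′ → trans (sym (Evens-sum e)) (Evens-sum e′)) (enum-evens H) (enum-distinct (suc H)))

  enum-triples : Enumerates (triples H) Triple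
  enum-triples = enum-⊠ (λ p p′ → trans (sym (Pair-sum p)) (Pair-sum p′)) enum-pairs (enum-odds (suc H))

  triple-sound : ∀ {n π₁ π₂ π₃} → Triple n ((π₂ , π₁) , π₃) →
                 PD π₁ × PE π₂ × PO π₃ × sum π₁ + sum π₂ + sum π₃ ≡ n
  triple-sound {π₁ = π₁} {π₂} (_ , _ , refl , p , (_ , refl , o)) =
    let (po , s) = odds-sound o
    in proj₁ (pair p) , proj₂ (pair p) , po ,
       cong₂ _+_ (trans (ℕₚ.+-comm (sum π₁) (sum π₂)) (Pair-sum p)) s
    where
    pair : ∀ {n π₁ π₂} → Pair n (π₂ , π₁) → PD π₁ × PE π₂
    pair (inj₁ (_ , refl , pd , _)) = pd , record { parts-positive = [] ; nonincreasing = [] } , []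
    pair (inj₂ (_ , _ , _ , (_ , refl , ne) , pd , _)) = pd , proj₁ (proj₂ (evens-sound ne))

  triple-complete : ∀ {π₁ π₂ π₃} → PD π₁ → PE π₂ → PO π₃ → sum π₁ + sum π₂ + sum π₃ ≤ H →
                    Triple (sum π₁ + sum π₂ + sum π₃) ((π₂ , π₁) , π₃)
  triple-complete {π₁} {π₂} {π₃} pd pe po s≤H =
    sum π₁ + sum π₂ , sum π₃ , refl , pair π₂ pe (ℕₚ.m+n≤o⇒n≤o (sum π₁) s₁+s₂≤H) ,
    odds-complete po (ℕₚ.m≤n⇒m≤1+n s₃≤H)
    where
    s₁+s₂≤H : sum π₁ + sum π₂ ≤ H
    s₁+s₂≤H = ℕₚ.m+n≤o⇒m≤o (sum π₁ + sum π₂) s≤H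
    s₃≤H : sum π₃ ≤ H
    s₃≤H = ℕₚ.m+n≤o⇒n≤o (sum π₁ + sum π₂) s≤H
    distinct₁ : HasDistinct (suc H) (sum π₁) π₁
    distinct₁ = distinct-complete pd (ℕₚ.m≤n⇒m≤1+n (ℕₚ.m+n≤o⇒m≤o (sum π₁) s₁+s₂≤H))

    pair : ∀ σ → PE σ → sum σ ≤ H → Pair (sum π₁ + sum σ) (σ , π₁)
    pair []          _  _   = inj₁ (π₁ , refl ,
      subst (λ n → HasDistinct (suc H) n π₁) (sym (ℕₚ.+-identityʳ (sum π₁))) distinct₁)
    pair σ@(_ ∷ _) pe s≤ = inj₂ (sum σ , sum π₁ , ℕₚ.+-comm (sum σ) (sum π₁) ,
      evens-complete (λ ()) pe s≤ , distinct₁)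

-- Counting the overpartitions with a given crank2

lookup-injective : ∀ {A : Set} {xs : List A} → Unique xs → ∀ i j → lookup xs i ≡ lookup xs j → i ≡ j
lookup-injective (_ ∷ _)  zero    zero    _  = refl
lookup-injective (x∉ ∷ _) zero    (suc j) eq = contradiction eq (All.lookup x∉ (∈-lookup j))
lookup-injective (x∉ ∷ _) (suc i) zero    eq = contradiction (sym eq) (All.lookup x∉ (∈-lookup i))
lookup-injective (_ ∷ u)  (suc i) (suc j) eq = cong suc (lookup-injective u i j eq)

module _ (n : ℕ) (m : ℤ) where
  private
    -- This is the bound used for the modulus `N = n`, so the lists counted are those behind the
    -- series `T`.
    H = suc n
    crank2ₜ : (List ℕ × List ℕ) × List ℕ → ℤ
    crank2ₜ = crank2ₚ ∘ proj₁

  withCrank2 : List ((List ℕ × List ℕ) × List ℕ)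
  withCrank2 = filter (λ t → crank2ₜ t ℤ.≟ m) (triples H n)

  private
    ∈ₜ? : ∀ t xs → Dec (t ∈ xs)
    ∈ₜ? = ∈?-from (Productₚ.≡-dec (Productₚ.≡-dec (≡-dec ℕ._≟_) (≡-dec ℕ._≟_)) (≡-dec ℕ._≟_))

    Result : Set
    Result = ∃[ π ] crank2 {n} π ≡ m

    triple : Result → (List ℕ × List ℕ) × List ℕ
    triple (π , _) = (π₂ , π₁) , π₃
      where open Overpartition π

    member : ∀ r → triple r ∈ withCrank2
    member (record { π₁ = π₁ ; π₂ = π₂ ; π₃ = π₃ ; π₁∈PD = pd ; π₂∈PE = pe ; π₃∈PO = po ; size = s } , eq) =
      -- The validity proofs of an overpartition are irrelevant, but list membership is decidable
      -- and can therefore be recovered from them.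
      recompute (∈ₜ? _ withCrank2) (∈-filter⁺ (λ t → crank2ₜ t ℤ.≟ m)
        (subst (λ k → ((π₂ , π₁) , π₃) ∈ triples H k) s
          (complete (enum-triples H)
            (triple-complete H pd pe po (ℕₚ.≤-trans (ℕₚ.≤-reflexive s) (ℕₚ.n≤1+n n))))) eq)

    result : ∀ t → t ∈ withCrank2 → Result
    result ((π₂ , π₁) , π₃) t∈ = record
      { π₁ = π₁ ; π₂ = π₂ ; π₃ = π₃
      ; π₁∈PD = proj₁ valid
      ; π₂∈PE = proj₁ (proj₂ valid)
      ; π₃∈PO = proj₁ (proj₂ (proj₂ valid))
      ; size  = proj₂ (proj₂ (proj₂ valid))
      } , proj₂ (∈-filter⁻ (λ t → crank2ₜ t ℤ.≟ m) {xs = triples H n} t∈)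
      where
      valid : PD π₁ × PE π₂ × PO π₃ × sum π₁ + sum π₂ + sum π₃ ≡ n
      valid = triple-sound H (sound (enum-triples H)
        (proj₁ (∈-filter⁻ (λ t → crank2ₜ t ℤ.≟ m) {xs = triples H n} t∈)))

    -- With irrelevant validity proofs, two results over the same triple can differ only in the
    -- proof about `crank2`, and equality proofs in `ℤ` are unique.
    result-triple : ∀ r {t} (t∈ : t ∈ withCrank2) → triple r ≡ t → result t t∈ ≡ r
    result-triple (π , eq) t∈ refl = cong (π ,_) (≡-irrelevant _ eq)
      where open Decidable⇒UIP ℤ._≟_ using (≡-irrelevant)

  overpartitions↔ : Fin (length withCrank2) ↔ Result
  overpartitions↔ = mk↔ₛ′ (λ i → result (lookup withCrank2 i) (∈-lookup i)) (index ∘ member)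
    (λ r → result-triple r _ (lookup-index (member r)))
    (λ i → lookup-injective (Uniqueₚ.filter⁺ (λ t → crank2ₜ t ℤ.≟ m) (unique (enum-triples H) n)) _ i
             (sym (lookup-index (member (result (lookup withCrank2 i) (∈-lookup i))))))

  -- The coefficient of zᵐ counts the entries of weight `m`, and working modulo q^(n+1) still
  -- retains the coefficient of qⁿ.
  count≡M2 : + length withCrank2 ≡ M2 m n
  count≡M2 = trans (sym (count crank2ₜ m (triples H n)))
    (_≋_.coeffs (_≈[_]_.at (GeneratingFunction.T≈M2 n) n ℕₚ.≤-refl) m)

theorem1p4 : (n : ℕ) (m : ℤ) →
    ∃[ k ] ((Fin k ↔ (∃[ π ] crank2 {n} π ≡ m)) × + k ≡ M2 m n)
theorem1p4 n m = length (withCrank2 n m) , overpartitions↔ n m , count≡M2 n m
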